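{- Let $\mathscr D=([n],\mathcal J)$ be a nondegenerate discrete polymatroid, let $\omega:[n]\to\mathbb R_{>0}$ be a positive weight function, and let $1\le k<\mathrm{rk}(\mathscr D)$. Then $$\mathrm J_{\omega}(k)^2\ =\ \Bigl(1+\frac1k\Bigr)\,\mathrm J_{\omega}(k-1)\,\mathrm J_{\omega}(k+1)$$ if and only if $\mathrm{polygirth}(\mathscr D)>k+1$.
   Context: A discrete polymatroid $\mathscr D=([n],\mathcal J)$ consists of $[n]=\{1,\dots,n\}$ and a nonempty finite set $\mathcal J\subset\mathbb N^n$ (with $0\in\mathbb N$) such that: (hereditary) $a\in\mathcal J$, $b\in\mathbb N^n$, $b\le a$ componentwise imply $b\in\mathcal J$; (exchange) $a,b\in\mathcal J$, $|a|<|b|$ imply there is $i\in[n]$ with $a_i<b_i$ and $a+e_i\in\mathcal J$. Here $|a|=a_1+\dots+a_n$ and $e_1,\dots,e_n$ is the standard basis. $\mathrm{rk}(\mathscr D)=\max\{|a|:a\in\mathcal J\}$, $\mathcal J_k=\{a\in\mathcal J:|a|=k\}$, $\mathrm J(k)=|\mathcal J_k|$. $\mathscr D$ is nondegenerate if $e_i\in\mathcal J$ for every $i\in[n]$. Define $\mathrm{polygirth}(\mathscr D)=\min\{k:\mathrm J(k)<\binom{n+k-1}{k}\}$; thus every $a\in\mathbb N^n$ with $|a|<\mathrm{polygirth}(\mathscr D)$ lies in $\mathcal J$. Put $\omega(a)=\prod_i\omega(i)^{a_i}$, $a!=\prod_i a_i!$, and $\mathrm J_\omega(k)=\sum_{a\in\mathcal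 J_k}\omega(a)/a!$. -}

module Defs where

open import Level using (_⊔_) renaming (suc to lsuc)
open import Algebra.Apartness.Bundles using (HeytingField; HeytingCommutativeRing)
open import Algebra.Bundles using (CommutativeRing)
import Algebra.Definitions.RawMonoid as RawMonoid
import Algebra.Apartness.Properties.HeytingCommutativeRing as HCRProperties
import Algebra.Properties.Ring as RingProperties
import Algebra.Properties.Monoid.Mult as Mult
import Algebra.Properties.Semiring.Exp as Exp
open import Data.Empty using (⊥-elim)
open import Data.Fin.Base using (Fin; zero; suc)
open import Data.List.Base as List using (List; []; filter; length; upTo)
open import Data.List.Extrema.Nat using (max; min; min≤xs; argmin-sel; xs≤max)
open import Data.List.Membership.Propositional using (_∈_)
open import Data.List.Membership.Propositional.Properties
  using (∈-filter⁺; ∈-filter⁻; ∈-upTo⁺; ∈-map⁺)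
import Data.List.Properties as List
open import Data.List.Relation.Unary.All as All using (All)
open import Data.List.Relation.Unary.Unique.Propositional using (Unique)
open import Data.Nat.Base as ℕ using (ℕ; zero; suc; NonZero; _∸_; _!)
open import Data.Nat.Combinatorics using (_C_; nCn≡1; nCk+nC[k+1]≡[n+1]C[k+1])
import Data.Nat.Properties as ℕ
open import Data.Product.Base using (∃-syntax; _×_; _,_; proj₁; proj₂)
open import Data.Sum.Base using (_⊎_; inj₁; inj₂)
open import Data.Vec.Base as Vec using (Vec; lookup; replicate; zipWith; _[_]≔_)
open import Function.Base using (id)
open import Relation.Binary.Core using (Rel)
open import Relation.Unary using (Decidable)
open import Relation.Binary.PropositionalEquality.Core as ≡ using (_≡_; _≢_)
open import Relation.Nullary.Decidable.Core using (yes; no)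
open import Relation.Binary.Structures using (IsStrictPartialOrder)

private
  variable
    n : ℕ

-- An Archimedean, Cauchy-complete ordered field.  Classically these
-- axioms determine ℝ up to unique isomorphism.  They avoid decidability
-- of the order, so the constructive (Bishop) reals satisfy them too.

record RealField c ℓ₁ ℓ₂ : Set (lsuc (c ⊔ ℓ₁ ⊔ ℓ₂)) where
  infix 4 _<_

  field
    heytingField : HeytingField c ℓ₁ ℓ₂

  open HeytingField heytingField public

  field
    _<_                    : Rel Carrier ℓ₂
    <-isStrictPartialOrder : IsStrictPartialOrder _≈_ _<_
    #⇒<⊎>                  : ∀ {x y} → x # y → x < y ⊎ y < x
    <⇒#                    : ∀ {x y} → x < y → x # y
    +-monoˡ-<              : ∀ {x y} z → x < y → x + z < y + z
    *-pos                  : ∀ {x y} → 0# < x → 0# < y → 0# < x * y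

  open HeytingCommutativeRing heytingCommutativeRing public
    using (commutativeRing)
  open CommutativeRing commutativeRing public
    using (ring; semiring; +-monoid; *-rawMonoid)

  open Mult +-monoid public
    using () renaming (_×_ to _·_)
  open Exp semiring public
    using (_^_)

  -- The usual |s p − s q| < ε, as p and q may be interchanged.
  IsCauchy : (ℕ → Carrier) → Set (c ⊔ ℓ₂)
  IsCauchy s = ∀ ε → 0# < ε →
    ∃[ N ] (∀ p q → N ℕ.≤ p → N ℕ.≤ q → s p - s q < ε)

  _ConvergesTo_ : (ℕ → Carrier) → Carrier → Set (c ⊔ ℓ₂)
  s ConvergesTo x = ∀ ε → 0# < ε →
    ∃[ N ] (∀ p → N ℕ.≤ p → s p - x < ε × x - s p < ε)

  field
    archimedean : ∀ x → ∃[ m ] x < m · 1#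
    complete    : ∀ s → IsCauchy s → ∃[ x ] s ConvergesTo x

  open IsStrictPartialOrder <-isStrictPartialOrder public
    using (<-respʳ-≈; <-respˡ-≈)
    renaming (irrefl to <-irrefl; trans to <-trans)

  0<1 : 0# < 1#
  0<1 with #⇒<⊎> (HCRProperties.1#0 heytingCommutativeRing)
  ... | inj₂ 0<1 = 0<1
  ... | inj₁ 1<0 = <-respʳ-≈ -1*-1≈1 (*-pos 0<-1 0<-1)
    where
    open RingProperties ring using (-1*x≈-x; -‿involutive)
    0<-1 : 0# < - 1#
    0<-1 = <-respˡ-≈ (-‿inverseʳ 1#)
             (<-respʳ-≈ (+-identityˡ (- 1#)) (+-monoˡ-< (- 1#) 1<0))
    -1*-1≈1 : - 1# * - 1# ≈ 1#
    -1*-1≈1 = trans (-1*x≈-x (- 1#)) (-‿involutive 1#)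

  0<[1+m]·1 : ∀ m → 0# < suc m · 1#
  0<[1+m]·1 zero    = <-respʳ-≈ (sym (+-identityʳ 1#)) 0<1
  0<[1+m]·1 (suc m) = <-trans (0<[1+m]·1 m)
    (<-respˡ-≈ (+-identityˡ _) (+-monoˡ-< (suc m · 1#) 0<1))

  m·1#0 : ∀ m .{{_ : NonZero m}} → m · 1# # 0#
  m·1#0 (suc m) = #-sym (<⇒# (0<[1+m]·1 m))

  recip : ∀ m .{{_ : NonZero m}} → Carrier
  recip m = proj₁ (#⇒invertible (m·1#0 m))

  recip-inverse : ∀ m .{{_ : NonZero m}} → m · 1# * recip m ≈ 1#
  recip-inverse m = trans
    (*-congʳ (sym (HCRProperties.x-0≈x heytingCommutativeRing (m · 1#))))
    (proj₂ (proj₂ (#⇒invertible (m·1#0 m))))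

infix  4 _≤ᵛ_
infixl 6 _+ᵛ_

_≤ᵛ_ : Rel (Vec ℕ n) _
a ≤ᵛ b = ∀ i → lookup a i ℕ.≤ lookup b i

_+ᵛ_ : Vec ℕ n → Vec ℕ n → Vec ℕ n
_+ᵛ_ = zipWith ℕ._+_

𝐞 : Fin n → Vec ℕ n
𝐞 i = replicate _ 0 [ i ]≔ 1

∣_∣ : Vec ℕ n → ℕ
∣_∣ = Vec.sum

∏ᴺ : (Fin n → ℕ) → ℕ
∏ᴺ = RawMonoid.sum ℕ.*-1-rawMonoid

infix 8 _!ᵛ

_!ᵛ : Vec ℕ n → ℕ
a !ᵛ = ∏ᴺ (λ i → lookup a i !)

!ᵛ-nonZero : (a : Vec ℕ n) → NonZero (a !ᵛ)
!ᵛ-nonZero Vec.[]      = _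
!ᵛ-nonZero (x Vec.∷ a) = ℕ.m*n≢0 (x !) (a !ᵛ) {{x ℕ.!≢0}} {{ !ᵛ-nonZero a }}

-- The finite set 𝒥 is given by a duplicate-free list of its elements.

record DiscretePolymatroid (n : ℕ) : Set where
  field
    𝒥          : List (Vec ℕ n)
    unique     : Unique 𝒥
    nonempty   : 𝒥 ≢ []
    hereditary : ∀ {a b} → a ∈ 𝒥 → b ≤ᵛ a → b ∈ 𝒥
    exchange   : ∀ {a b} → a ∈ 𝒥 → b ∈ 𝒥 → ∣ a ∣ ℕ.< ∣ b ∣ →
                 ∃[ i ] lookup a i ℕ.< lookup b i × a +ᵛ 𝐞 i ∈ 𝒥

  rk : ℕ
  rk = max 0 (List.map ∣_∣ 𝒥)

  𝒥[_] : ℕ → List (Vec ℕ n)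
  𝒥[ k ] = filter (λ a → ∣ a ∣ ℕ.≟ k) 𝒥

  J : ℕ → ℕ
  J k = length 𝒥[ k ]

  Nondegenerate : Set
  Nondegenerate = ∀ i → 𝐞 i ∈ 𝒥

  -- For n = k = 0 the truncated subtraction gives 0 C 0 = 1, which agrees
  -- with the convention (-1 choose 0) = 1.
  Deficient : ℕ → Set
  Deficient k = J k ℕ.< (n ℕ.+ k ∸ 1) C k

  deficient? : Decidable Deficient
  deficient? k = J k ℕ.<? (n ℕ.+ k ∸ 1) C k

  -- The least deficient k.  When n ≠ 0, the number 1 + rk is deficient, so
  -- it suffices to search the k < 2 + rk and the default value 2 + rk of
  -- the minimum is not attained; see polygirth-deficient and
  -- polygirth-least.  When n = 0 nothing is deficient (and rk = 0).
  polygirth : ℕ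
  polygirth = min (2 ℕ.+ rk) (filter deficient? (upTo (2 ℕ.+ rk)))

private
  0<[m+k]Ck : ∀ m k → 0 ℕ.< (m ℕ.+ k) C k
  0<[m+k]Ck m       zero    = ℕ.s≤s ℕ.z≤n
  0<[m+k]Ck zero    (suc k) = ℕ.≤-reflexive (≡.sym (nCn≡1 (suc k)))
  0<[m+k]Ck (suc m) (suc k) =
    ≡.subst (0 ℕ.<_) (nCk+nC[k+1]≡[n+1]C[k+1] (m ℕ.+ suc k) k)
      (ℕ.<-≤-trans (0<[m+k]Ck m (suc k)) (ℕ.m≤n+m _ _))

module _ (D : DiscretePolymatroid n) where
  open DiscretePolymatroid D

  ∣a∣≤rk : ∀ {a} → a ∈ 𝒥 → ∣ a ∣ ℕ.≤ rk
  ∣a∣≤rk a∈𝒥 = All.lookup (xs≤max 0 (List.map ∣_∣ 𝒥)) (∈-map⁺ ∣_∣ a∈𝒥)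

  J[1+rk]≡0 : J (suc rk) ≡ 0
  J[1+rk]≡0 = ≡.cong length (List.filter-none (λ a → ∣ a ∣ ℕ.≟ suc rk)
    (All.tabulate λ a∈𝒥 ∣a∣≡1+rk → ℕ.1+n≰n (≡.subst (ℕ._≤ rk) ∣a∣≡1+rk (∣a∣≤rk a∈𝒥))))

  1+rk-deficient : .{{NonZero n}} → Deficient (suc rk)
  1+rk-deficient rewrite J[1+rk]≡0 = go n
    where
    go : ∀ m .{{_ : NonZero m}} → 0 ℕ.< (m ℕ.+ suc rk ∸ 1) C suc rk
    go (suc m) = 0<[m+k]Ck m (suc rk)

  private
    candidates = filter deficient? (upTo (2 ℕ.+ rk))

    polygirth≤candidate : ∀ {k} → Deficient k → k ℕ.< 2 ℕ.+ rk → polygirth ℕ.≤ k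
    polygirth≤candidate def k<2+rk =
      All.lookup (min≤xs (2 ℕ.+ rk) candidates)
        (∈-filter⁺ deficient? (∈-upTo⁺ k<2+rk) def)

  polygirth-least : .{{NonZero n}} → ∀ {k} → Deficient k → polygirth ℕ.≤ k
  polygirth-least {k} def with k ℕ.<? 2 ℕ.+ rk
  ... | yes k<2+rk = polygirth≤candidate def k<2+rk
  ... | no  k≮2+rk = ℕ.≤-trans
    (polygirth≤candidate 1+rk-deficient ℕ.≤-refl)
    (ℕ.≤-trans (ℕ.n≤1+n _) (ℕ.≮⇒≥ k≮2+rk))

  polygirth-deficient : .{{NonZero n}} → Deficient polygirth
  polygirth-deficient with argmin-sel id (2 ℕ.+ rk) candidates
  ... | inj₁ pg≡2+rk = ⊥-elim (ℕ.1+n≰n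
    (≡.subst (ℕ._≤ suc rk) pg≡2+rk (polygirth≤candidate 1+rk-deficient ℕ.≤-refl)))
  ... | inj₂ pg∈     = proj₂ (∈-filter⁻ deficient? {xs = upTo (2 ℕ.+ rk)} pg∈)

module Weighted {c ℓ₁ ℓ₂} (R : RealField c ℓ₁ ℓ₂) where
  open RealField R

  ∏ : (Fin n → Carrier) → Carrier
  ∏ = RawMonoid.sum *-rawMonoid

  weight : (Fin n → Carrier) → Vec ℕ n → Carrier
  weight ω a = ∏ (λ i → ω i ^ lookup a i)

  term : (Fin n → Carrier) → Vec ℕ n → Carrier
  term ω a = weight ω a * recip (a !ᵛ) {{ !ᵛ-nonZero a }}

  Jω : DiscretePolymatroid n → (Fin n → Carrier) → ℕ → Carrier
  Jω D ω k = List.foldr _+_ 0# (List.map (term ω) 𝒥[ k ])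
    where open DiscretePolymatroid D

{-# OPTIONS --safe #-}

-- Let A k be the ω-weighted number of words of length k over [n] whose content lies in 𝒥.
-- A vector a is the content of |a|! / a! words, so A k = k! Jω k, and the equation to be
-- characterised reads A k * A k = A (k-1) * A (k+1).
--
-- Write h = (0, ω).  On ℝ^{1+n} let B(i, j) be the weighted number of words w of length k-1
-- such that content(w) + e_i + e_j ∈ 𝒥, where e_0 = 0.  Then A (k-1), A k and A (k+1) are the
-- values of B at (e₀, e₀), (e₀, h) and (h, h).  The form B is Lorentzian: for k = 1 it is a
-- square minus a sum of squares, one for each parallel class; and in general B = Σ_l ω_l B_l
-- with B_l the form of the contraction by l.  Adding the summands one at a time, the partial
-- sum N of the terms l < j satisfies N e_j = B_j (Σ_{l<j} ω_l e_l), since B_l e_j = B_j e_l.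
-- Both N and B_j are nonpositive on the kernel of this linear form, hence so is N + ω_j B_j.
--
-- If equality holds, then z = B(h, h) e₀ - B(e₀, h) h is isotropic and orthogonal to h, so it
-- lies in the kernel of B.  It is then also isotropic and orthogonal to h for every B_l, and
-- descending to k = 1 shows that { i : a + e_i ∈ 𝒥 } has the same weight for all a ∈ 𝒥 with
-- |a| = k-1 or |a| = k.  These sets decrease with a, so they agree at a and a + e_i, and the
-- exchange axiom then puts every vector of size at most k+1 into 𝒥.

module Submission where

open import Defs
open import Algebra.Bundles using (CommutativeMonoid; CommutativeRing)
import Algebra.Apartness.Properties.HeytingCommutativeRing as HCRProperties
import Algebra.Properties.CommutativeMonoid.Sum as CommutativeMonoidSum
import Algebra.Properties.CommutativeSemigroup as CommutativeSemigroupProperties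
import Algebra.Properties.Ring as RingProperties
import Algebra.Properties.Semiring.Mult as SemiringMult
import Algebra.Properties.Semiring.Mult.TCOptimised as SemiringMultTCOptimised
import Algebra.Properties.Semiring.Sum as SemiringSum
import Algebra.Solver.Ring as RingSolver
open import Algebra.Solver.Ring.AlmostCommutativeRing
  using (fromCommutativeRing; _-Raw-AlmostCommutative⟶_)
open import Data.Bool.Base using (Bool; true; false; T; _∧_; not)
open import Data.Bool.Properties using (T-∧)
open import Data.Empty using (⊥; ⊥-elim)
open import Data.Fin.Base using (Fin; zero; suc)
open import Data.Fin.Properties using (_≟_; any?)
import Data.Integer.Base as ℤ
import Data.Integer.Properties as ℤ
open import Data.List.Base as List using (List; []; _∷_; _++_; length; filter)
open import Data.List.Extrema.Nat using (argmax-sel)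
import Data.List.Membership.DecPropositional as DecMembership
open import Data.List.Membership.Propositional using (_∈_; _∉_)
open import Data.List.Membership.Propositional.Properties
  using (∈-filter⁺; ∈-filter⁻; ∈-map⁺; ∈-map⁻; ∈-++⁺ˡ; ∈-++⁺ʳ; ∈-++⁻; ∈-∃++)
import Data.List.Properties as List
open import Data.List.Relation.Unary.All as All using (All; []; _∷_)
open import Data.List.Relation.Unary.AllPairs using ([]; _∷_)
open import Data.List.Relation.Unary.Any using (here; there)
open import Data.List.Relation.Unary.Unique.Propositional using (Unique)
import Data.List.Relation.Unary.Unique.Propositional.Properties as Unique
open import Data.Maybe.Base using (Maybe; just; nothing)
open import Data.Nat.Base as ℕ using (ℕ; zero; suc; NonZero; _∸_; _!)
open import Data.Nat.Combinatorics using (_C_; nCk+nC[k+1]≡[n+1]C[k+1]; k>n⇒nCk≡0)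
import Data.Nat.Properties as ℕ
open import Data.Product.Base using (∃-syntax; _×_; _,_; proj₁; proj₂)
open import Data.Sum.Base using (_⊎_; inj₁; inj₂; [_,_]′)
open import Data.Vec.Base as Vec using (Vec; []; _∷_; lookup; replicate)
import Data.Vec.Properties as Vec
open import Function.Base using (_∘_; id)
open import Function.Bundles using (_⇔_; mk⇔; Equivalence)
open import Relation.Binary.PropositionalEquality as ≡ using (_≡_; _≢_)
import Relation.Binary.Reasoning.Setoid as ≈-Reasoning
open import Relation.Nullary using (¬_; Dec; yes; no; contradiction)
open import Relation.Nullary.Decidable using (⌊_⌋)

-- Vectors of natural numbers

module Combinatorics where
  open import Data.Nat.Base using (_≤_; _<_; _+_; z≤n; s≤s; _⊔_)
  open ≡ using (refl; sym; trans; cong; cong₂; subst; module ≡-Reasoning)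
  open CommutativeSemigroupProperties ℕ.+-commutativeSemigroup using (interchange)

  0ᵛ : ∀ {n} → Vec ℕ n
  0ᵛ = replicate _ 0

  lookup-+ᵛ : ∀ {n} (a b : Vec ℕ n) i → lookup (a +ᵛ b) i ≡ lookup a i + lookup b i
  lookup-+ᵛ a b i = Vec.lookup-zipWith _+_ i a b

  +ᵛ-comm : ∀ {n} (a b : Vec ℕ n) → a +ᵛ b ≡ b +ᵛ a
  +ᵛ-comm = Vec.zipWith-comm ℕ.+-comm

  +ᵛ-assoc : ∀ {n} (a b c : Vec ℕ n) → (a +ᵛ b) +ᵛ c ≡ a +ᵛ (b +ᵛ c)
  +ᵛ-assoc = Vec.zipWith-assoc ℕ.+-assoc

  +ᵛ-identityʳ : ∀ {n} (a : Vec ℕ n) → a +ᵛ 0ᵛ ≡ a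
  +ᵛ-identityʳ = Vec.zipWith-identityʳ ℕ.+-identityʳ

  +ᵛ-identityˡ : ∀ {n} (a : Vec ℕ n) → 0ᵛ +ᵛ a ≡ a
  +ᵛ-identityˡ = Vec.zipWith-identityˡ ℕ.+-identityˡ

  +ᵛ-swap : ∀ {n} (a b c : Vec ℕ n) → (a +ᵛ b) +ᵛ c ≡ (a +ᵛ c) +ᵛ b
  +ᵛ-swap a b c = trans (+ᵛ-assoc a b c) (trans (cong (a +ᵛ_) (+ᵛ-comm b c)) (sym (+ᵛ-assoc a c b)))

  ∣∣-+ᵛ : ∀ {n} (a b : Vec ℕ n) → ∣ a +ᵛ b ∣ ≡ ∣ a ∣ + ∣ b ∣
  ∣∣-+ᵛ []      []      = refl
  ∣∣-+ᵛ (x ∷ a) (y ∷ b) =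
    trans (cong ((x + y) +_) (∣∣-+ᵛ a b)) (interchange x y (Vec.sum a) (Vec.sum b))

  ∣0ᵛ∣≡0 : ∀ n → ∣ 0ᵛ {n} ∣ ≡ 0
  ∣0ᵛ∣≡0 zero    = refl
  ∣0ᵛ∣≡0 (suc n) = ∣0ᵛ∣≡0 n

  ∣𝐞∣≡1 : ∀ {n} (i : Fin n) → ∣ 𝐞 i ∣ ≡ 1
  ∣𝐞∣≡1 {suc n} zero = cong suc (∣0ᵛ∣≡0 n)
  ∣𝐞∣≡1 (suc i)      = ∣𝐞∣≡1 i

  lookup-𝐞-≡ : ∀ {n} (i : Fin n) → lookup (𝐞 i) i ≡ 1
  lookup-𝐞-≡ i = Vec.lookup∘updateAt i 0ᵛ

  lookup-𝐞-≢ : ∀ {n} {i j : Fin n} → j ≢ i → lookup (𝐞 i) j ≡ 0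
  lookup-𝐞-≢ {i = i} {j} j≢i =
    trans (Vec.lookup∘updateAt′ j i j≢i 0ᵛ) (Vec.lookup-replicate j 0)

  -- The extra index zero stands for the empty step.
  infixl 6 _⊕_
  _⊕_ : ∀ {n} → Vec ℕ n → Fin (suc n) → Vec ℕ n
  a ⊕ zero  = a
  a ⊕ suc i = a +ᵛ 𝐞 i

  ⊕-comm : ∀ {n} (a : Vec ℕ n) i j → a ⊕ i ⊕ j ≡ a ⊕ j ⊕ i
  ⊕-comm a zero    j       = refl
  ⊕-comm a (suc i) zero    = refl
  ⊕-comm a (suc i) (suc j) = +ᵛ-swap a (𝐞 i) (𝐞 j)

  +ᵛ-⊕ : ∀ {n} (a b : Vec ℕ n) i → (a +ᵛ b) ⊕ i ≡ a +ᵛ (b ⊕ i)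
  +ᵛ-⊕ a b zero    = refl
  +ᵛ-⊕ a b (suc i) = +ᵛ-assoc a b (𝐞 i)

  ∣⊕∣ : ∀ {n} (a : Vec ℕ n) i → ∣ a ⊕ suc i ∣ ≡ suc ∣ a ∣
  ∣⊕∣ a i = trans (∣∣-+ᵛ a (𝐞 i)) (trans (cong (∣ a ∣ +_) (∣𝐞∣≡1 i)) (ℕ.+-comm ∣ a ∣ 1))

  lookup-⊕-≡ : ∀ {n} (a : Vec ℕ n) i → lookup (a ⊕ suc i) i ≡ suc (lookup a i)
  lookup-⊕-≡ a i = trans (lookup-+ᵛ a (𝐞 i) i)
    (trans (cong (lookup a i +_) (lookup-𝐞-≡ i)) (ℕ.+-comm (lookup a i) 1))

  lookup-⊕-≢ : ∀ {n} (a : Vec ℕ n) {i j} → j ≢ i → lookup (a ⊕ suc i) j ≡ lookup a j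
  lookup-⊕-≢ a {i} {j} j≢i = trans (lookup-+ᵛ a (𝐞 i) j)
    (trans (cong (lookup a j +_) (lookup-𝐞-≢ j≢i)) (ℕ.+-identityʳ _))

  ≤ᵛ-refl : ∀ {n} {a : Vec ℕ n} → a ≤ᵛ a
  ≤ᵛ-refl i = ℕ.≤-refl

  ≤ᵛ-trans : ∀ {n} {a b c : Vec ℕ n} → a ≤ᵛ b → b ≤ᵛ c → a ≤ᵛ c
  ≤ᵛ-trans p q i = ℕ.≤-trans (p i) (q i)

  a≤a+b : ∀ {n} (a b : Vec ℕ n) → a ≤ᵛ a +ᵛ b
  a≤a+b a b i = ℕ.≤-trans (ℕ.m≤m+n _ _) (ℕ.≤-reflexive (sym (lookup-+ᵛ a b i)))

  a≤a⊕i : ∀ {n} (a : Vec ℕ n) i → a ≤ᵛ a ⊕ i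
  a≤a⊕i a zero    = ≤ᵛ-refl {a = a}
  a≤a⊕i a (suc i) = a≤a+b a (𝐞 i)

  ⊕-monoˡ-≤ᵛ : ∀ {n} {a b : Vec ℕ n} i → a ≤ᵛ b → a ⊕ i ≤ᵛ b ⊕ i
  ⊕-monoˡ-≤ᵛ zero p = p
  ⊕-monoˡ-≤ᵛ {a = a} {b} (suc i) p j
    rewrite lookup-+ᵛ a (𝐞 i) j | lookup-+ᵛ b (𝐞 i) j = ℕ.+-monoˡ-≤ _ (p j)

  ⊕-≤ᵛ : ∀ {n} {a b : Vec ℕ n} {i} → a ≤ᵛ b → lookup a i < lookup b i → a ⊕ suc i ≤ᵛ b
  ⊕-≤ᵛ {a = a} {b} {i} p q j with j ≟ i
  ... | yes refl = ℕ.≤-trans (ℕ.≤-reflexive (lookup-⊕-≡ a i)) q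
  ... | no j≢i   = ℕ.≤-trans (ℕ.≤-reflexive (lookup-⊕-≢ a j≢i)) (p j)

  ∣∣-mono : ∀ {n} {a b : Vec ℕ n} → a ≤ᵛ b → ∣ a ∣ ≤ ∣ b ∣
  ∣∣-mono {a = []}    {[]}    p = z≤n
  ∣∣-mono {a = x ∷ a} {y ∷ b} p = ℕ.+-mono-≤ (p zero) (∣∣-mono {a = a} {b} (p ∘ suc))

  ≤ᵛ∧∣∣≥⇒≡ : ∀ {n} {a b : Vec ℕ n} → a ≤ᵛ b → ∣ b ∣ ≤ ∣ a ∣ → a ≡ b
  ≤ᵛ∧∣∣≥⇒≡ {a = []}    {[]}    p q = refl
  ≤ᵛ∧∣∣≥⇒≡ {a = x ∷ a} {y ∷ b} p q = cong₂ _∷_ x≡y (≤ᵛ∧∣∣≥⇒≡ (p ∘ suc)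
      (ℕ.+-cancelˡ-≤ x ∣ b ∣ ∣ a ∣ (subst (λ t → t + ∣ b ∣ ≤ x + ∣ a ∣) (sym x≡y) q)))
    where
    x≡y : x ≡ y
    x≡y = ℕ.≤-antisym (p zero) (ℕ.≮⇒≥ λ x<y →
      ℕ.<⇒≱ (ℕ.+-mono-<-≤ x<y (∣∣-mono {a = a} {b} (p ∘ suc))) q)

  0ᵛ≤a : ∀ {n} (a : Vec ℕ n) → 0ᵛ ≤ᵛ a
  0ᵛ≤a a i = subst (_≤ lookup a i) (sym (Vec.lookup-replicate i 0)) z≤n

  ∣a∣≡0⇒0ᵛ≡a : ∀ {n} (a : Vec ℕ n) → ∣ a ∣ ≡ 0 → 0ᵛ ≡ a
  ∣a∣≡0⇒0ᵛ≡a {n} a ∣a∣≡0 = ≤ᵛ∧∣∣≥⇒≡ (0ᵛ≤a a) (subst (_≤ ∣ 0ᵛ {n} ∣) (sym ∣a∣≡0) z≤n)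

  ≤ᵛ-complement : ∀ {n} {a b : Vec ℕ n} → a ≤ᵛ b → ∃[ c ] b ≡ a +ᵛ c
  ≤ᵛ-complement {a = []}    {[]}    p = [] , refl
  ≤ᵛ-complement {a = x ∷ a} {y ∷ b} p with ≤ᵛ-complement {a = a} {b} (p ∘ suc)
  ... | c , b≡a+c = (y ∸ x) ∷ c , cong₂ _∷_ (sym (ℕ.m+[n∸m]≡n (p zero))) b≡a+c

  ∣a∣≡suc⇒⊕ : ∀ {n m} (a : Vec ℕ n) → ∣ a ∣ ≡ suc m → ∃[ b ] ∃[ i ] a ≡ b ⊕ suc i
  ∣a∣≡suc⇒⊕ (zero  ∷ a) p with ∣a∣≡suc⇒⊕ a p
  ... | b , i , refl = zero ∷ b , suc i , refl
  ∣a∣≡suc⇒⊕ (suc x ∷ a) p = x ∷ a , zero ,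
    cong₂ _∷_ (ℕ.+-comm 1 x) (sym (+ᵛ-identityʳ a))

  ≤ᵛ∧∣∣-suc⇒⊕ : ∀ {n} {a b : Vec ℕ n} → a ≤ᵛ b → ∣ b ∣ ≡ suc ∣ a ∣ → ∃[ i ] b ≡ a ⊕ suc i
  ≤ᵛ∧∣∣-suc⇒⊕ {a = a} {b} a≤b ∣b∣≡ with ≤ᵛ-complement {a = a} {b} a≤b
  ... | c , refl with ℕ.+-cancelˡ-≡ ∣ a ∣ ∣ c ∣ 1 (trans (sym (∣∣-+ᵛ a c)) (trans ∣b∣≡ (ℕ.+-comm 1 ∣ a ∣)))
  ...   | ∣c∣≡1 with ∣a∣≡suc⇒⊕ c ∣c∣≡1
  ...     | d , i , refl = i , cong (a +ᵛ_) (trans (cong (_⊕ suc i) (sym 0≡d)) (+ᵛ-identityˡ (𝐞 i)))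
    where
    0≡d : 0ᵛ ≡ d
    0≡d = ∣a∣≡0⇒0ᵛ≡a d (ℕ.suc-injective (trans (sym (∣⊕∣ d i)) ∣c∣≡1))

  -- Enumeration of the vectors of a given size

  bump : ∀ {n} → Vec ℕ (suc n) → Vec ℕ (suc n)
  bump (x ∷ a) = suc x ∷ a

  -- The recursion separates vectors with first entry zero from those whose first entry can be
  -- lowered by one. This is Pascal's rule, so the length is a binomial coefficient.
  ofSize : ∀ n → ℕ → List (Vec ℕ n)
  ofSize zero    zero    = [] ∷ []
  ofSize zero    (suc k) = []
  ofSize (suc n) zero    = 0ᵛ ∷ []
  ofSize (suc n) (suc k) = List.map (0 ∷_) (ofSize n (suc k)) ++ List.map bump (ofSize (suc n) k)

  length-ofSize : ∀ n k → length (ofSize n k) ≡ (n + k ∸ 1) C k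
  length-ofSize zero    zero    = refl
  -- Here the upper index `0 + suc k ∸ 1` computes to `k`, which is below `suc k`.
  length-ofSize zero    (suc k) = sym (k>n⇒nCk≡0 (ℕ.n<1+n k))
  length-ofSize (suc n) zero    = refl
  length-ofSize (suc n) (suc k) = begin
    length (List.map (0 ∷_) (ofSize n (suc k)) ++ List.map bump (ofSize (suc n) k))
      ≡⟨ List.length-++ (List.map (0 ∷_) (ofSize n (suc k))) ⟩
    length (List.map (0 ∷_) (ofSize n (suc k))) + length (List.map bump (ofSize (suc n) k))
      ≡⟨ cong₂ _+_ (List.length-map (0 ∷_) (ofSize n (suc k))) (List.length-map bump (ofSize (suc n) k)) ⟩
    length (ofSize n (suc k)) + length (ofSize (suc n) k)
      ≡⟨ cong₂ _+_ (length-ofSize n (suc k)) (length-ofSize (suc n) k) ⟩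
    (n + suc k ∸ 1) C suc k + (n + k) C k
      ≡⟨ cong (λ t → (t ∸ 1) C suc k + (n + k) C k) (ℕ.+-suc n k) ⟩
    (n + k) C suc k + (n + k) C k
      ≡⟨ ℕ.+-comm ((n + k) C suc k) _ ⟩
    (n + k) C k + (n + k) C suc k
      ≡⟨ nCk+nC[k+1]≡[n+1]C[k+1] (n + k) k ⟩
    suc (n + k) C suc k
      ≡⟨ cong (_C suc k) (sym (ℕ.+-suc n k)) ⟩
    (n + suc k) C suc k ∎
    where open ≡-Reasoning

  ∈-ofSize⁺ : ∀ {n} (a : Vec ℕ n) → a ∈ ofSize n ∣ a ∣
  ∈-ofSize⁺ a = go _ a refl
    where
    go : ∀ {n} k (a : Vec ℕ n) → ∣ a ∣ ≡ k → a ∈ ofSize n k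
    go zero []          p = here refl
    go zero (zero ∷ a)  p = here (sym (∣a∣≡0⇒0ᵛ≡a (zero ∷ a) p))
    go (suc k) (zero ∷ a)  p = ∈-++⁺ˡ (∈-map⁺ (0 ∷_) (go (suc k) a p))
    go {suc n} (suc k) (suc x ∷ a) p =
      ∈-++⁺ʳ (List.map (0 ∷_) (ofSize n (suc k))) (∈-map⁺ bump (go k (x ∷ a) (ℕ.suc-injective p)))

  ∈-ofSize⁻ : ∀ {n} k {a : Vec ℕ n} → a ∈ ofSize n k → ∣ a ∣ ≡ k
  ∈-ofSize⁻ {zero}  zero (here refl) = refl
  ∈-ofSize⁻ {suc n} zero (here refl) = ∣0ᵛ∣≡0 n
  ∈-ofSize⁻ {suc n} (suc k) a∈ with ∈-++⁻ (List.map (0 ∷_) (ofSize n (suc k))) a∈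
  ... | inj₁ a∈ˡ with ∈-map⁻ (0 ∷_) a∈ˡ
  ...   | _ , b∈ , refl = ∈-ofSize⁻ (suc k) b∈
  ∈-ofSize⁻ {suc n} (suc k) a∈ | inj₂ a∈ʳ with ∈-map⁻ bump a∈ʳ
  ...   | x ∷ b , b∈ , refl = cong suc (∈-ofSize⁻ k b∈)

  ofSize-unique : ∀ n k → Unique (ofSize n k)
  ofSize-unique zero    zero    = [] ∷ []
  ofSize-unique zero    (suc k) = []
  ofSize-unique (suc n) zero    = [] ∷ []
  ofSize-unique (suc n) (suc k) = Unique.++⁺
    (Unique.map⁺ Vec.∷-injectiveʳ (ofSize-unique n (suc k)))
    (Unique.map⁺ bump-injective (ofSize-unique (suc n) k))
    λ (p , q) → disjoint p q
    where
    bump-injective : ∀ {a b : Vec ℕ (suc n)} → bump a ≡ bump b → a ≡ b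
    bump-injective {x ∷ a} {_ ∷ _} refl = refl
    disjoint : ∀ {a} → a ∈ List.map (0 ∷_) (ofSize n (suc k)) → a ∈ List.map bump (ofSize (suc n) k) → ⊥
    disjoint p q with ∈-map⁻ (0 ∷_) p | ∈-map⁻ bump q
    ... | _ , _ , refl | _ ∷ _ , _ , ()

  -- Pigeonhole: the head of `xs` is cut out of `ys`, and the rest of `xs`, which does not contain
  -- it, stays inside what is left.
  length-mono-⊆ : ∀ {a} {A : Set a} {xs ys : List A} → Unique xs → (∀ {x} → x ∈ xs → x ∈ ys) →
                  length xs ≤ length ys
  length-mono-⊆ {xs = []}     u p = z≤n
  length-mono-⊆ {xs = x ∷ xs} {ys} (x∉xs ∷ u) p with ∈-∃++ (p (here refl))
  ... | us , vs , refl = ℕ.≤-trans (s≤s (length-mono-⊆ u q)) (ℕ.≤-reflexive (sym lem))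
    where
    lem : length (us ++ x ∷ vs) ≡ suc (length (us ++ vs))
    lem = trans (List.length-++ us) (trans (ℕ.+-suc _ _) (cong suc (sym (List.length-++ us))))
    q : ∀ {y} → y ∈ xs → y ∈ us ++ vs
    q y∈ with ∈-++⁻ us (p (there y∈))
    ... | inj₁ y∈us         = ∈-++⁺ˡ y∈us
    ... | inj₂ (here refl)  = ⊥-elim (All.lookup x∉xs y∈ refl)
    ... | inj₂ (there y∈vs) = ∈-++⁺ʳ us y∈vs

  -- Exchange in a discrete polymatroid

  module Polymatroid {n : ℕ} (D : DiscretePolymatroid n) where
    open DiscretePolymatroid D

    infix 4 _∈?𝒥
    _∈?𝒥 : (a : Vec ℕ n) → Dec (a ∈ 𝒥)
    a ∈?𝒥 = DecMembership._∈?_ (Vec.≡-dec ℕ._≟_) a 𝒥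

    0ᵛ∈𝒥 : 0ᵛ ∈ 𝒥
    0ᵛ∈𝒥 with 𝒥 in eq
    ... | []    = ⊥-elim (nonempty eq)
    ... | a ∷ _ = subst (0ᵛ ∈_) eq (hereditary (subst (a ∈_) (sym eq) (here refl)) (0ᵛ≤a a))

    ⊕-∈⁻ : ∀ {a} i → a ⊕ i ∈ 𝒥 → a ∈ 𝒥
    ⊕-∈⁻ {a} i a⊕i∈ = hereditary a⊕i∈ (a≤a⊕i a i)

    ⊕-∈⁻ʳ : ∀ {a} i j → a ⊕ i ⊕ j ∈ 𝒥 → a ⊕ j ∈ 𝒥
    ⊕-∈⁻ʳ {a} i j p = ⊕-∈⁻ i (subst (_∈ 𝒥) (⊕-comm a i j) p)

    -- Exchange against `b` adds one unit at a time. Each unit goes to an entry still below that of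
    -- `b`, so no entry ever exceeds the larger of the two original ones.
    grow : ∀ {a b} → a ∈ 𝒥 → b ∈ 𝒥 → ∀ {t} → ∣ a ∣ ≤ t → t ≤ ∣ b ∣ →
           ∃[ c ] c ∈ 𝒥 × a ≤ᵛ c × ∣ c ∣ ≡ t × (∀ i → lookup c i ≤ lookup a i ⊔ lookup b i)
    grow {a} {b} a∈ b∈ {t} a≤t t≤b = go (t ∸ ∣ a ∣) a∈ (≤ᵛ-refl {a = a}) (ℕ.m∸n+n≡m a≤t) (λ i → ℕ.m≤m⊔n _ _)
      where
      go : ∀ d {a′} → a′ ∈ 𝒥 → a ≤ᵛ a′ → d + ∣ a′ ∣ ≡ t → (∀ i → lookup a′ i ≤ lookup a i ⊔ lookup b i) →
           ∃[ c ] c ∈ 𝒥 × a ≤ᵛ c × ∣ c ∣ ≡ t × (∀ i → lookup c i ≤ lookup a i ⊔ lookup b i)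
      go zero {a′} a′∈ a≤a′ eq bd = a′ , a′∈ , a≤a′ , eq , bd
      go (suc d) {a′} a′∈ a≤a′ eq bd
        with exchange a′∈ b∈ (ℕ.≤-trans (s≤s (ℕ.m≤n+m ∣ a′ ∣ d)) (ℕ.≤-trans (ℕ.≤-reflexive eq) t≤b))
      ... | i , a′<b , a′i∈ = go d a′i∈ (≤ᵛ-trans {a = a} {a′} {a′ ⊕ suc i} a≤a′ (a≤a⊕i a′ (suc i)))
              (trans (trans (cong (d +_) (∣⊕∣ a′ i)) (ℕ.+-suc d ∣ a′ ∣)) eq)
              bd′
        where
        bd′ : ∀ j → lookup (a′ ⊕ suc i) j ≤ lookup a j ⊔ lookup b j
        bd′ j with j ≟ i
        ... | yes refl = ℕ.≤-trans (ℕ.≤-reflexive (lookup-⊕-≡ a′ i)) (ℕ.≤-trans a′<b (ℕ.m≤n⊔m _ _))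
        ... | no j≢i   = ℕ.≤-trans (ℕ.≤-reflexive (lookup-⊕-≢ a′ j≢i)) (bd j)

    -- Growing `a ⊕ suc j` towards `(a ⊕ suc i) +ᵛ w` never raises entry `i`, since that would put
    -- `a ⊕ suc i ⊕ suc j` into `𝒥`. The outcome therefore lies below `(a ⊕ suc j) +ᵛ w` and, having
    -- the same size, equals it.
    parallel : ∀ {a i j} → a ⊕ suc j ∈ 𝒥 → a ⊕ suc i ⊕ suc j ∉ 𝒥 →
               ∀ w → (a ⊕ suc i) +ᵛ w ∈ 𝒥 → (a ⊕ suc j) +ᵛ w ∈ 𝒥
    parallel {a} {i} {j} aj∈ aij∉ w aiw∈ with i ≟ j
    ... | yes refl = aiw∈
    ... | no i≢j with grow aj∈ aiw∈ ∣aj∣≤ ℕ.≤-refl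
      where
      ∣aj∣≤ : ∣ a ⊕ suc j ∣ ≤ ∣ (a ⊕ suc i) +ᵛ w ∣
      ∣aj∣≤ rewrite ∣∣-+ᵛ (a ⊕ suc i) w | ∣⊕∣ a i | ∣⊕∣ a j = s≤s (ℕ.m≤m+n _ _)
    ... | c , c∈ , aj≤c , ∣c∣≡ , c≤ = subst (_∈ 𝒥) c≡ c∈
      where
      c≤ajw : c ≤ᵛ (a ⊕ suc j) +ᵛ w
      c≤ajw k with k ≟ i
      ... | yes refl = ℕ.≤-trans
          (ℕ.≮⇒≥ λ lt → aij∉ (hereditary c∈
            (subst (_≤ᵛ c) (⊕-comm a (suc j) (suc i)) (⊕-≤ᵛ {a = a ⊕ suc j} {c} aj≤c lt))))
                         (a≤a+b (a ⊕ suc j) w i)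
      ... | no k≢i = ℕ.≤-trans (c≤ k) (ℕ.⊔-lub (a≤a+b (a ⊕ suc j) w k)
          (ℕ.≤-trans (ℕ.≤-reflexive (trans (lookup-+ᵛ (a ⊕ suc i) w k)
            (cong (_+ lookup w k) (lookup-⊕-≢ a k≢i))))
          (ℕ.≤-trans (ℕ.+-monoˡ-≤ (lookup w k) (a≤a⊕i a (suc j) k))
            (ℕ.≤-reflexive (sym (lookup-+ᵛ (a ⊕ suc j) w k))))))
      c≡ : c ≡ (a ⊕ suc j) +ᵛ w
      c≡ = ≤ᵛ∧∣∣≥⇒≡ c≤ajw (ℕ.≤-reflexive (sym (trans ∣c∣≡ (trans (∣∣-+ᵛ (a ⊕ suc i) w)
             (trans (cong (_+ ∣ w ∣) (trans (∣⊕∣ a i) (sym (∣⊕∣ a j)))) (sym (∣∣-+ᵛ (a ⊕ suc j) w)))))))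

    -- Polygirth and the fullness of the lower levels

    Full : ℕ → Set
    Full k = ∀ a → ∣ a ∣ ≤ k → a ∈ 𝒥

    rk-attained : ∀ {k} → k < rk → ∃[ a ] a ∈ 𝒥 × suc k ≤ ∣ a ∣
    rk-attained {k} k<rk with argmax-sel id 0 (List.map ∣_∣ 𝒥)
    -- The default value 0 of the maximum is excluded because `rk` exceeds `k`.
    ... | inj₁ rk≡0 = contradiction (subst (k <_) rk≡0 k<rk) ℕ.n≮0
    ... | inj₂ rk∈ with ∈-map⁻ ∣_∣ rk∈
    ...   | a , a∈ , rk≡∣a∣ = a , a∈ , subst (k <_) rk≡∣a∣ k<rk

    -- `𝒥[ l ]` contains the duplicate-free enumeration of all vectors of size `l`, whose length is
    -- the binomial coefficient.
    Full⇒¬Deficient : ∀ {k} → Full k → ∀ {l} → l ≤ k → ¬ Deficient l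
    Full⇒¬Deficient full {l} l≤k = ℕ.≤⇒≯ (subst (_≤ J l) (length-ofSize n l)
      (length-mono-⊆ (ofSize-unique n l) λ a∈ →
        ∈-filter⁺ (λ a → ∣ a ∣ ℕ.≟ l) (full _ (ℕ.≤-trans (ℕ.≤-reflexive (∈-ofSize⁻ l a∈)) l≤k))
            (∈-ofSize⁻ l a∈)))

    -- A missing `a` could be put in front of `𝒥[ ∣ a ∣ ]` without repetition. The longer list would
    -- still consist of vectors of size `∣ a ∣`, so that level would be deficient.
    ¬Deficient⇒Full : ∀ {k} → (∀ {l} → l ≤ k → ¬ Deficient l) → Full k
    ¬Deficient⇒Full nd a ∣a∣≤k with a ∈?𝒥
    ... | yes a∈ = a∈
    ... | no  a∉ = contradiction
        (subst (suc (J ∣ a ∣) ≤_) (length-ofSize n ∣ a ∣) (length-mono-⊆ unique′ ⊆ofSize))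
        (nd ∣a∣≤k)
      where
      unique′ : Unique (a ∷ 𝒥[ ∣ a ∣ ])
      unique′ = All.tabulate (λ b∈ a≡b → a∉
          (subst (_∈ 𝒥) (sym a≡b) (proj₁ (∈-filter⁻ (λ b → ∣ b ∣ ℕ.≟ ∣ a ∣) b∈))))
                ∷ Unique.filter⁺ (λ b → ∣ b ∣ ℕ.≟ ∣ a ∣) unique
      ⊆ofSize : ∀ {b} → b ∈ a ∷ 𝒥[ ∣ a ∣ ] → b ∈ ofSize n ∣ a ∣
      ⊆ofSize (here refl) = ∈-ofSize⁺ a
      ⊆ofSize {b} (there b∈) = subst (λ t → b ∈ ofSize n t)
        (proj₂ (∈-filter⁻ (λ b → ∣ b ∣ ℕ.≟ ∣ a ∣) {xs = 𝒥} b∈)) (∈-ofSize⁺ b)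

    Full⇒polygirth> : .{{NonZero n}} → ∀ {k} → Full k → polygirth ℕ.> k
    Full⇒polygirth> full = ℕ.≰⇒> λ pg≤k → Full⇒¬Deficient full pg≤k (polygirth-deficient D)

    polygirth>⇒Full : .{{NonZero n}} → ∀ {k} → polygirth ℕ.> k → Full k
    polygirth>⇒Full pg>k = ¬Deficient⇒Full λ l≤k def →
      ℕ.<⇒≱ pg>k (ℕ.≤-trans (polygirth-least D def) l≤k)

    -- Fullness from the absence of parallel elements at one level

    module _ (nondegenerate : Nondegenerate) {m top} (top∈ : top ∈ 𝒥) (2+m≤top : 2 + m ≤ ∣ top ∣)
             (closed : ∀ {a} i j → ∣ a ∣ ≡ m → a ⊕ suc i ∈ 𝒥 → a ⊕ suc j ∈ 𝒥 → a ⊕ suc i ⊕ suc j ∈ 𝒥)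
             where

      private
        -- Enlarging e_i within a gives u + e_i ∈ 𝒥 with a = u + e_l.  If a + e_j ∈ 𝒥, then exchange
        -- adds e_l or e_j to u + e_i; in the second case the hypothesis applies to u + e_j.
        level-m : ∀ {a} → a ∈ 𝒥 → ∣ a ∣ ≡ m → ∀ i → a ⊕ suc i ∈ 𝒥
        level-m {a} a∈ ∣a∣≡m i with ℕ.m≤n⇒m<n∨m≡n (z≤n {m})
        -- For `m = 0` the vector `a` is zero, and the claim is nondegeneracy.
        ... | inj₂ 0≡m = subst (_∈ 𝒥)
                (trans (sym (+ᵛ-identityˡ (𝐞 i))) (cong (_⊕ suc i) (∣a∣≡0⇒0ᵛ≡a a (trans ∣a∣≡m (sym 0≡m)))))
                (nondegenerate i)
        ... | inj₁ 0<m with grow (nondegenerate i) a∈ {m} (ℕ.≤-trans (ℕ.≤-reflexive (∣𝐞∣≡1 i)) 0<m)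
            (ℕ.≤-reflexive (sym ∣a∣≡m))
        ...   | c , c∈ , e≤c , ∣c∣≡ , c≤ with ≤ᵛ-complement {a = 𝐞 i} {c} e≤c
        ...     | u , refl with ≤ᵛ∧∣∣-suc⇒⊕ {a = u} {a} u≤a
            (trans ∣a∣≡m (sym (trans (sym (∣⊕∣ u i)) (trans (cong ∣_∣ (+ᵛ-comm u (𝐞 i))) ∣c∣≡))))
          where
          u≤a : u ≤ᵛ a
          -- If `a` were below `u` at `j`, then `u` would be positive there, so both entries in the
          -- join would lie strictly below that of `𝐞 i +ᵛ u`.
          u≤a j = ℕ.≮⇒≥ λ a<u → ℕ.<⇒≱
            (ℕ.⊔-pres-<m (ℕ.m<m+n _ (ℕ.≤-trans (s≤s z≤n) a<u)) (ℕ.≤-trans a<u (ℕ.m≤n+m _ _)))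
            (ℕ.≤-trans (ℕ.≤-reflexive (sym (lookup-+ᵛ (𝐞 i) u j))) (c≤ j))
        ...       | l , refl = finish
          where
          ui∈ : u ⊕ suc i ∈ 𝒥
          ui∈ = subst (_∈ 𝒥) (+ᵛ-comm (𝐞 i) u) c∈
          finish : u ⊕ suc l ⊕ suc i ∈ 𝒥
          finish with exchange a∈ top∈ (ℕ.≤-trans (ℕ.≤-trans (s≤s (ℕ.≤-reflexive ∣a∣≡m)) (ℕ.n≤1+n _)) 2+m≤top)
          ... | j , _ , ulj∈ with exchange ui∈ ulj∈
              (ℕ.≤-reflexive (trans (cong suc (trans (∣⊕∣ u i) (sym (∣⊕∣ u l))))
                (sym (∣⊕∣ (u ⊕ suc l) j))))
          ...   | j′ , lt , uij′∈ with j′ ≟ l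
          ...     | yes refl = subst (_∈ 𝒥) (⊕-comm u (suc i) (suc l)) uij′∈
          ...     | no j′≢l with j′ ≟ j
          ...       | yes refl = ⊕-∈⁻ (suc j)
              (subst (_∈ 𝒥) eq (closed l i (trans (∣⊕∣ u j) (trans (sym (∣⊕∣ u l)) ∣a∣≡m))
                      (subst (_∈ 𝒥) (⊕-comm u (suc l) (suc j)) ulj∈)
                        (subst (_∈ 𝒥) (⊕-comm u (suc i) (suc j)) uij′∈)))
            where
            eq : u ⊕ suc j ⊕ suc l ⊕ suc i ≡ u ⊕ suc l ⊕ suc i ⊕ suc j
            eq = trans (cong (_⊕ suc i) (⊕-comm u (suc j) (suc l))) (⊕-comm (u ⊕ suc l) (suc j) (suc i))
          -- Away from `l` and `j` the larger vector agrees with `u`, so exchange cannot have chosen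
          -- any other index.
          ...       | no j′≢j = ⊥-elim
              (ℕ.<⇒≱ lt (ℕ.≤-trans (ℕ.≤-reflexive
                (trans (lookup-⊕-≢ (u ⊕ suc l) j′≢j) (lookup-⊕-≢ u j′≢l))) (a≤a⊕i u (suc i) j′)))

        -- Growing `a` to size `m` towards `top` reduces this to `level-m`, and heredity brings the
        -- result back down.
        step : ∀ {a} → a ∈ 𝒥 → ∣ a ∣ ≤ m → ∀ i → a ⊕ suc i ∈ 𝒥
        step {a} a∈ ∣a∣≤m i with grow a∈ top∈ ∣a∣≤m (ℕ.≤-trans (ℕ.m≤n+m m 2) 2+m≤top)
        ... | c , c∈ , a≤c , ∣c∣≡m , _ = hereditary (level-m c∈ ∣c∣≡m i) (⊕-monoˡ-≤ᵛ {a = a} {c} (suc i) a≤c)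

      -- Repeated use of `step` reaches every vector of size at most `1 + m`. A vector of size
      -- `2 + m` is `d` of size `m` with two more units; each unit can be added to `d` separately,
      -- and `closed` adds both.
      extension-closed⇒Full : Full (2 + m)
      extension-closed⇒Full a = go _ a refl
        where
        go : ∀ s a → ∣ a ∣ ≡ s → s ≤ 2 + m → a ∈ 𝒥
        go zero a eq _ = subst (_∈ 𝒥) (∣a∣≡0⇒0ᵛ≡a a eq) 0ᵛ∈𝒥
        go (suc s) a eq le with ∣a∣≡suc⇒⊕ a eq
        ... | b , i , refl with ℕ.suc-injective (trans (sym (∣⊕∣ b i)) eq)
        ...   | ∣b∣≡s with go s b ∣b∣≡s (ℕ.≤-trans (ℕ.n≤1+n s) le) | ℕ.m≤n⇒m<n∨m≡n le
        ...     | b∈ | inj₁ lt = step b∈ (ℕ.≤-trans (ℕ.≤-reflexive ∣b∣≡s) (ℕ.s≤s⁻¹ (ℕ.s≤s⁻¹ lt))) i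
        ...     | b∈ | inj₂ refl with ∣a∣≡suc⇒⊕ b ∣b∣≡s
        ...       | d , j , refl = closed j i ∣d∣≡m b∈ (step (⊕-∈⁻ (suc j) b∈) (ℕ.≤-reflexive ∣d∣≡m) i)
          where
          ∣d∣≡m : ∣ d ∣ ≡ m
          ∣d∣≡m = ℕ.suc-injective (trans (sym (∣⊕∣ d j)) ∣b∣≡s)

open Combinatorics

-- The integers as coefficients: the polynomial solver must be able to
-- decide when a coefficient vanishes.
module IntegerSolver {c ℓ} (R : CommutativeRing c ℓ) where
  open CommutativeRing R hiding (zero)
  open import Data.Integer.Base using (ℤ; +_; -[1+_])
  open RingProperties ring
  open SemiringMultTCOptimised semiring renaming (_×_ to _·_)
  open ≈-Reasoning setoid

  private
    almostCommutativeRing = fromCommutativeRing R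

    -- The optimised multiple makes the image of 1 compute to `1#` itself, so that `1-homo` is
    -- `refl`.
    ⟦_⟧ : ℤ → Carrier
    ⟦ + n ⟧      = n · 1#
    ⟦ -[1+ n ] ⟧ = - (suc n · 1#)

    ⟦⊖⟧ : ∀ m n → ⟦ m ℤ.⊖ n ⟧ ≈ m · 1# + - (n · 1#)
    ⟦⊖⟧ m       zero    = sym (trans (+-congˡ -0#≈0#) (+-identityʳ _))
    ⟦⊖⟧ zero    (suc n) = sym (+-identityˡ _)
    ⟦⊖⟧ (suc m) (suc n) = begin
      ⟦ suc m ℤ.⊖ suc n ⟧                ≡⟨ ≡.cong ⟦_⟧ (ℤ.[1+m]⊖[1+n]≡m⊖n m n) ⟩
      ⟦ m ℤ.⊖ n ⟧                        ≈⟨ ⟦⊖⟧ m n ⟩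
      a + - b                            ≈⟨ +-congʳ (sym (+-identityˡ a)) ⟩
      0# + a + - b                       ≈⟨ +-congʳ (+-congʳ (sym (-‿inverseʳ 1#))) ⟩
      1# + - 1# + a + - b
        ≈⟨ +-congʳ (trans (+-assoc _ _ _) (trans (+-congˡ (+-comm _ _)) (sym (+-assoc _ _ _)))) ⟩
      1# + a + - 1# + - b                ≈⟨ +-assoc _ _ _ ⟩
      1# + a + (- 1# + - b)              ≈⟨ +-congˡ (-‿+-comm 1# b) ⟩
      1# + a + - (1# + b)                ≈⟨ +-cong (1+× m 1#) (-‿cong (1+× n 1#)) ⟨
      suc m · 1# + - (suc n · 1#)        ∎
      where a = m · 1# ; b = n · 1#

    +-homo : ∀ i j → ⟦ i ℤ.+ j ⟧ ≈ ⟦ i ⟧ + ⟦ j ⟧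
    +-homo (+ m)    (+ n)    = ×-homo-+ 1# m n
    +-homo (+ m)    -[1+ n ] = ⟦⊖⟧ m (suc n)
    +-homo -[1+ m ] (+ n)    = trans (⟦⊖⟧ n (suc m)) (+-comm _ _)
    +-homo -[1+ m ] -[1+ n ] = begin
      - (suc (suc (m ℕ.+ n)) · 1#)       ≡⟨ ≡.cong (λ t → - (suc t · 1#)) (≡.sym (ℕ.+-suc m n)) ⟩
      - ((suc m ℕ.+ suc n) · 1#)         ≈⟨ -‿cong (×-homo-+ 1# (suc m) (suc n)) ⟩
      - (suc m · 1# + suc n · 1#)        ≈⟨ sym (-‿+-comm _ _) ⟩
      - (suc m · 1#) + - (suc n · 1#)    ∎

    -‿homo : ∀ i → ⟦ ℤ.- i ⟧ ≈ - ⟦ i ⟧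
    -‿homo (+ zero)  = sym -0#≈0#
    -‿homo (+ suc n) = refl
    -‿homo -[1+ n ]  = sym (-‿involutive _)

    *-homo⁺ : ∀ m j → ⟦ + m ℤ.* j ⟧ ≈ ⟦ + m ⟧ * ⟦ j ⟧
    *-homo⁺ zero j = sym (zeroˡ _)
    *-homo⁺ (suc m) j = begin
      ⟦ + suc m ℤ.* j ⟧                  ≡⟨ ≡.cong ⟦_⟧ (ℤ.suc-* (+ m) j) ⟩
      ⟦ j ℤ.+ + m ℤ.* j ⟧                ≈⟨ +-homo j (+ m ℤ.* j) ⟩
      ⟦ j ⟧ + ⟦ + m ℤ.* j ⟧              ≈⟨ +-congˡ (*-homo⁺ m j) ⟩
      ⟦ j ⟧ + m · 1# * ⟦ j ⟧             ≈⟨ +-congʳ (sym (*-identityˡ _)) ⟩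
      1# * ⟦ j ⟧ + m · 1# * ⟦ j ⟧        ≈⟨ sym (distribʳ _ _ _) ⟩
      (1# + m · 1#) * ⟦ j ⟧              ≈⟨ *-congʳ (1+× m 1#) ⟨
      suc m · 1# * ⟦ j ⟧                 ∎

    *-homo : ∀ i j → ⟦ i ℤ.* j ⟧ ≈ ⟦ i ⟧ * ⟦ j ⟧
    *-homo (+ m)    j = *-homo⁺ m j
    *-homo -[1+ m ] j = begin
      ⟦ -[1+ m ] ℤ.* j ⟧                 ≡⟨ ≡.cong ⟦_⟧ (≡.sym (ℤ.neg-distribˡ-* (+ suc m) j)) ⟩
      ⟦ ℤ.- (+ suc m ℤ.* j) ⟧            ≈⟨ -‿homo (+ suc m ℤ.* j) ⟩
      - ⟦ + suc m ℤ.* j ⟧                ≈⟨ -‿cong (*-homo⁺ (suc m) j) ⟩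
      - (suc m · 1# * ⟦ j ⟧)             ≈⟨ -‿distribˡ-* _ _ ⟩
      - (suc m · 1#) * ⟦ j ⟧             ∎

    morphism : ℤ.+-*-rawRing -Raw-AlmostCommutative⟶ almostCommutativeRing
    morphism = record
      { ⟦_⟧    = ⟦_⟧
      ; +-homo = +-homo
      ; *-homo = *-homo
      ; -‿homo = -‿homo
      ; 0-homo = refl
      ; 1-homo = refl
      }

    _≟⟦⟧_ : ∀ i j → Maybe (⟦ i ⟧ ≈ ⟦ j ⟧)
    i ≟⟦⟧ j with i ℤ.≟ j
    ... | yes i≡j = just (reflexive (≡.cong ⟦_⟧ i≡j))
    ... | no _    = nothing

  open RingSolver ℤ.+-*-rawRing almostCommutativeRing morphism _≟⟦⟧_ public
    using (Polynomial; solve; _:=_; _:+_; _:*_; :-_; _:-_; con)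

-- Order in a field without decidable comparison

module OrderedField {c ℓ₁ ℓ₂} (ℝ : RealField c ℓ₁ ℓ₂) where
  open RealField ℝ hiding (zero)
  open CommutativeRing commutativeRing public
    using (*-commutativeMonoid)
  open IntegerSolver commutativeRing public
  open SemiringSum semiring public
    using (sum; sum-cong-≋; ∑-distrib-+; ∑-comm; *-distribˡ-sum; *-distribʳ-sum; sum-replicate-zero)

  nil one : ∀ {m} → Polynomial m
  nil = con ℤ.0ℤ
  one = con ℤ.1ℤ

  <-resp : ∀ {x x′ y y′} → x ≈ x′ → y ≈ y′ → x < y → x′ < y′
  <-resp x≈x′ y≈y′ = <-respˡ-≈ x≈x′ ∘ <-respʳ-≈ y≈y′

  -- This substitute for trichotomy is inherited from apartness: `z` is apart from `x` or from `y`,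
  -- and apartness decides the sign of the difference.
  cotrans : ∀ {x y} z → x < y → x < z ⊎ z < y
  cotrans z x<y with #-cotrans (<⇒# x<y) z
  ... | inj₁ x#z with #⇒<⊎> x#z
  ...   | inj₁ x<z = inj₁ x<z
  ...   | inj₂ z<x = inj₂ (<-trans z<x x<y)
  cotrans z x<y | inj₂ z#y with #⇒<⊎> z#y
  ...   | inj₁ z<y = inj₂ z<y
  ...   | inj₂ y<z = inj₁ (<-trans x<y y<z)

  infix 4 _≤_
  -- As a negation, the weak order can be proved by refuting the strict reverse, even where no
  -- comparison can be decided.
  _≤_ : Carrier → Carrier → Set ℓ₂
  x ≤ y = ¬ (y < x)

  ≤-resp : ∀ {x x′ y y′} → x ≈ x′ → y ≈ y′ → x ≤ y → x′ ≤ y′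
  ≤-resp x≈x′ y≈y′ x≤y y′<x′ = x≤y (<-resp (sym y≈y′) (sym x≈x′) y′<x′)

  ≤-antisym : ∀ {x y} → x ≤ y → y ≤ x → x ≈ y
  ≤-antisym {x} {y} x≤y y≤x = proj₁ (tight x y) x#y⇒⊥
    where
    x#y⇒⊥ : ¬ (x # y)
    x#y⇒⊥ x#y with #⇒<⊎> x#y
    ... | inj₁ x<y = y≤x x<y
    ... | inj₂ y<x = x≤y y<x

  ≤-reflexive : ∀ {x y} → x ≈ y → x ≤ y
  ≤-reflexive x≈y y<x = <-irrefl (sym x≈y) y<x

  <⇒≤ : ∀ {x y} → x < y → x ≤ y
  <⇒≤ x<y y<x = <-irrefl refl (<-trans x<y y<x)

  <-≤-trans : ∀ {x y z} → x < y → y ≤ z → x < z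
  <-≤-trans {z = z} x<y y≤z with cotrans z x<y
  ... | inj₁ x<z = x<z
  ... | inj₂ z<y = ⊥-elim (y≤z z<y)

  ≤-trans : ∀ {x y z} → x ≤ y → y ≤ z → x ≤ z
  ≤-trans x≤y y≤z z<x = y≤z (<-≤-trans z<x x≤y)

  +-monoˡ-≤ : ∀ {x y} z → x ≤ y → x + z ≤ y + z
  +-monoˡ-≤ {x} {y} z x≤y y+z<x+z = x≤y (<-resp (cancel y z) (cancel x z) (+-monoˡ-< (- z) y+z<x+z))
    where
    cancel : ∀ x z → x + z + - z ≈ x
    cancel = solve 2 (λ x z → x :+ z :+ :- z := x) refl

  x≤x+y : ∀ {x y} → 0# ≤ y → x ≤ x + y
  x≤x+y {x} {y} 0≤y = ≤-resp (+-identityˡ x) (+-comm y x) (+-monoˡ-≤ x 0≤y)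

  +-nonneg : ∀ {x y} → 0# ≤ x → 0# ≤ y → 0# ≤ x + y
  +-nonneg 0≤x 0≤y = ≤-trans 0≤x (x≤x+y 0≤y)

  +-pos-nonneg : ∀ {x y} → 0# < x → 0# ≤ y → 0# < x + y
  +-pos-nonneg 0<x 0≤y = <-≤-trans 0<x (x≤x+y 0≤y)

  +-nonneg-pos : ∀ {x y} → 0# ≤ x → 0# < y → 0# < x + y
  +-nonneg-pos 0≤x 0<y = <-resp refl (+-comm _ _) (+-pos-nonneg 0<y 0≤x)

  x<0⇒0<-x : ∀ {x} → x < 0# → 0# < - x
  x<0⇒0<-x {x} x<0 = <-resp (-‿inverseʳ x) (+-identityˡ (- x)) (+-monoˡ-< (- x) x<0)

  0<-x⇒x<0 : ∀ {x} → 0# < - x → x < 0#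
  0<-x⇒x<0 {x} 0<-x = <-resp (+-identityˡ x) (-‿inverseˡ x) (+-monoˡ-< x 0<-x)

  x≤0⇒0≤-x : ∀ {x} → x ≤ 0# → 0# ≤ - x
  x≤0⇒0≤-x {x} x≤0 -x<0 = x≤0 (<-resp refl (solve 1 (λ x → :- (:- x) := x) refl x) (x<0⇒0<-x -x<0))

  -- The inverse of the product, multiplied by `y`, inverts `x`, and an invertible element is apart
  -- from zero.
  #0-factorˡ : ∀ {x y} → x * y # 0# → x # 0#
  #0-factorˡ {x} {y} xy#0 with #⇒invertible xy#0
  ... | z , z[xy-0]≈1 , _ = HCRProperties.invertibleˡ⇒# heytingCommutativeRing
    (z * y , trans (solve 3 (λ x y z → z :* y :* (x :- nil) := z :* (x :* y :- nil)) refl x y z) z[xy-0]≈1)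

  #0-factorʳ : ∀ {x y} → x * y # 0# → y # 0#
  #0-factorʳ {x} {y} xy#0 = #0-factorˡ (HCRProperties.#-congʳ heytingCommutativeRing (*-comm x y) xy#0)

  -- Assuming a negative product makes both factors apart from zero, so their signs become decidable
  -- and both must be positive.
  *-nonneg : ∀ {x y} → 0# ≤ x → 0# ≤ y → 0# ≤ x * y
  *-nonneg 0≤x 0≤y xy<0 =
    [ 0≤x , (λ 0<x → [ 0≤y , (λ 0<y → <⇒≤ (*-pos 0<x 0<y) xy<0) ]′ (#⇒<⊎> (#0-factorʳ (<⇒# xy<0)))) ]′
      (#⇒<⊎> (#0-factorˡ (<⇒# xy<0)))

  *-pos-neg : ∀ {x y} → x < 0# → y < 0# → 0# < x * y
  *-pos-neg {x} {y} x<0 y<0 = <-resp refl (solve 2 (λ x y → (:- x) :* (:- y) := x :* y) refl x y)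
    (*-pos (x<0⇒0<-x x<0) (x<0⇒0<-x y<0))

  square-nonneg : ∀ x → 0# ≤ x * x
  square-nonneg x xx<0 =
    [ (λ x<0 → <⇒≤ (*-pos-neg x<0 x<0) xx<0) , (λ 0<x → <⇒≤ (*-pos 0<x 0<x) xx<0) ]′
      (#⇒<⊎> (#0-factorˡ (<⇒# xx<0)))

  *-cancelˡ-nonneg : ∀ {x y} → 0# < x → 0# ≤ x * y → 0# ≤ y
  *-cancelˡ-nonneg {x} {y} 0<x 0≤xy y<0 = 0≤xy (0<-x⇒x<0 (<-resp refl
    (solve 2 (λ x y → x :* (:- y) := :- (x :* y)) refl x y) (*-pos 0<x (x<0⇒0<-x y<0))))

  *-cancelˡ-pos : ∀ {x y} → 0# < x → 0# < x * y → 0# < y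
  *-cancelˡ-pos {x} {y} 0<x 0<xy =
    [ (λ y<0 → ⊥-elim (<⇒≤ 0<xy (0<-x⇒x<0 (<-resp refl (solve 2 (λ x y → x :* :- y := :- (x :* y)) refl x y)
        (*-pos 0<x (x<0⇒0<-x y<0)))))) , (λ 0<y → 0<y) ]′
      (#⇒<⊎> (#0-factorʳ (#-sym (<⇒# 0<xy))))

  *-cancelˡ-0 : ∀ {x y} → 0# < x → x * y ≈ 0# → y ≈ 0#
  *-cancelˡ-0 {x} {y} 0<x xy≈0 = sym (≤-antisym 0≤y y≤0)
    where
    0≤y : 0# ≤ y
    0≤y = *-cancelˡ-nonneg 0<x (≤-reflexive (sym xy≈0))
    y≤0 : y ≤ 0#
    y≤0 0<y = <-irrefl (sym xy≈0) (*-pos 0<x 0<y)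

  *-cancelˡ : ∀ {x y z} → 0# < x → x * y ≈ x * z → y ≈ z
  *-cancelˡ {x} {y} {z} 0<x xy≈xz = trans (solve 2 (λ y z → y := (y :- z) :+ z) refl y z)
    (trans (+-congʳ (*-cancelˡ-0 0<x (trans (solve 3 (λ x y z → x :* (y :- z) := x :* y :- x :* z) refl x y z)
      (trans (+-congʳ xy≈xz) (-‿inverseʳ _))))) (+-identityˡ z))

  sum-nonneg : ∀ {n} (f : Fin n → Carrier) → (∀ i → 0# ≤ f i) → 0# ≤ sum f
  sum-nonneg {zero}  f 0≤f = ≤-reflexive refl
  sum-nonneg {suc n} f 0≤f = +-nonneg (0≤f zero) (sum-nonneg (f ∘ suc) (0≤f ∘ suc))

  sum-pos : ∀ {n} (f : Fin n → Carrier) → (∀ i → 0# ≤ f i) → ∀ i → 0# < f i → 0# < sum f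
  sum-pos f 0≤f zero    0<fi = +-pos-nonneg 0<fi (sum-nonneg (f ∘ suc) (0≤f ∘ suc))
  sum-pos f 0≤f (suc i) 0<fi = +-nonneg-pos (0≤f zero) (sum-pos (f ∘ suc) (0≤f ∘ suc) i 0<fi)

  sum-0 : ∀ {n} {f : Fin n → Carrier} → (∀ i → f i ≈ 0#) → sum f ≈ 0#
  sum-0 {n} f≈0 = trans (sum-cong-≋ f≈0) (sum-replicate-zero n)

  sum-nonneg-0 : ∀ {n} (f : Fin n → Carrier) → (∀ i → 0# ≤ f i) → sum f ≈ 0# → ∀ i → f i ≈ 0#
  sum-nonneg-0 f 0≤f Σ≈0 i = sym (≤-antisym (0≤f i) λ 0<fi → <-irrefl (sym Σ≈0) (sum-pos f 0≤f i 0<fi))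

-- Symmetric bilinear forms and the Lorentzian property

module Forms {c ℓ₁ ℓ₂} (ℝ : RealField c ℓ₁ ℓ₂) where
  open RealField ℝ hiding (zero)
  open OrderedField ℝ
  open ≈-Reasoning setoid

  Vector : ℕ → Set c
  Vector N = Fin N → Carrier

  Matrix : ℕ → Set c
  Matrix N = Fin N → Fin N → Carrier

  Symmetric : ∀ {N} → Matrix N → Set ℓ₁
  Symmetric A = ∀ i j → A i j ≈ A j i

  infix 4 _≋_
  _≋_ : ∀ {N} → Matrix N → Matrix N → Set ℓ₁
  A ≋ B = ∀ i j → A i j ≈ B i j

  infixl 7 _·ᵛ_
  _·ᵛ_ : ∀ {N} → Carrier → Vector N → Vector N
  (a ·ᵛ x) i = a * x i

  infixl 6 _⊹_
  _⊹_ : ∀ {N} → Vector N → Vector N → Vector N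
  (x ⊹ y) i = x i + y i

  dot : ∀ {N} → Vector N → Vector N → Carrier
  dot x y = sum (λ i → x i * y i)

  infixr 7 _⊡_
  _⊡_ : ∀ {N} → Matrix N → Vector N → Vector N
  (A ⊡ x) i = dot (A i) x

  Q : ∀ {N} → Matrix N → Vector N → Vector N → Carrier
  Q A x y = dot x (A ⊡ y)

  dot-cong : ∀ {N} {x x′ y y′ : Vector N} → (∀ i → x i ≈ x′ i) → (∀ i → y i ≈ y′ i) → dot x y ≈ dot x′ y′
  dot-cong x≈x′ y≈y′ = sum-cong-≋ (λ i → *-cong (x≈x′ i) (y≈y′ i))

  dot-comm : ∀ {N} (x y : Vector N) → dot x y ≈ dot y x
  dot-comm x y = sum-cong-≋ (λ i → *-comm (x i) (y i))

  dot-+ˡ : ∀ {N} (x y z : Vector N) → dot (x ⊹ y) z ≈ dot x z + dot y z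
  dot-+ˡ x y z = trans (sum-cong-≋ (λ i → distribʳ (z i) (x i) (y i)))
      (∑-distrib-+ (λ i → x i * z i) (λ i → y i * z i))

  dot-·ˡ : ∀ {N} a (x z : Vector N) → dot (a ·ᵛ x) z ≈ a * dot x z
  dot-·ˡ a x z = trans (sum-cong-≋ (λ i → *-assoc a (x i) (z i))) (sym (*-distribˡ-sum a (λ i → x i * z i)))

  dot-sumˡ : ∀ {N t} (x : Fin t → Vector N) (z : Vector N) →
             dot (λ i → sum (λ s → x s i)) z ≈ sum (λ s → dot (x s) z)
  dot-sumˡ x z = trans (sum-cong-≋ (λ i → *-distribʳ-sum (z i) (λ s → x s i))) (∑-comm (λ i s → x s i * z i))

  unit : ∀ {N} → Fin N → Vector N
  unit zero    zero    = 1#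
  unit zero    (suc i) = 0#
  unit (suc j) zero    = 0#
  unit (suc j) (suc i) = unit j i

  unit-nonneg : ∀ {N} (j i : Fin N) → 0# ≤ unit j i
  unit-nonneg zero    zero    = <⇒≤ 0<1
  unit-nonneg zero    (suc i) = ≤-reflexive refl
  unit-nonneg (suc j) zero    = ≤-reflexive refl
  unit-nonneg (suc j) (suc i) = unit-nonneg j i

  dot-unit : ∀ {N} j (x : Vector N) → dot (unit j) x ≈ x j
  dot-unit zero    x = trans (+-cong (*-identityˡ (x zero)) (sum-0 (λ i → zeroˡ (x (suc i))))) (+-identityʳ _)
  dot-unit (suc j) x = trans (+-cong (zeroˡ _) (dot-unit j (x ∘ suc))) (+-identityˡ _)

  Q-congᴹ : ∀ {N} {A B : Matrix N} → A ≋ B → ∀ x y → Q A x y ≈ Q B x y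
  Q-congᴹ A≋B x y = dot-cong {x = x} (λ i → refl) (λ i → dot-cong {y = y} (A≋B i) (λ j → refl))

  Q-sym : ∀ {N} {A : Matrix N} → Symmetric A → ∀ x y → Q A x y ≈ Q A y x
  Q-sym {A = A} A-sym x y = begin
    sum (λ i → x i * sum (λ j → A i j * y j))
      ≈⟨ sum-cong-≋ (λ i → *-distribˡ-sum (x i) (λ j → A i j * y j)) ⟩
    sum (λ i → sum (λ j → x i * (A i j * y j)))   ≈⟨ ∑-comm (λ i j → x i * (A i j * y j)) ⟩
    sum (λ j → sum (λ i → x i * (A i j * y j)))   ≈⟨ sum-cong-≋ (λ j → sum-cong-≋ (λ i → lem i j)) ⟩
    sum (λ j → sum (λ i → y j * (A j i * x i)))
      ≈⟨ sum-cong-≋ (λ j → *-distribˡ-sum (y j) (λ i → A j i * x i)) ⟨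
    sum (λ j → y j * sum (λ i → A j i * x i))     ∎
    where
    lem : ∀ i j → x i * (A i j * y j) ≈ y j * (A j i * x i)
    lem i j = trans (solve 3 (λ x a y → x :* (a :* y) := y :* (a :* x)) refl (x i) (A i j) (y j))
                    (*-congˡ (*-congʳ (A-sym i j)))

  Q-linˡ : ∀ {N} (A : Matrix N) a x b y z → Q A (a ·ᵛ x ⊹ b ·ᵛ y) z ≈ a * Q A x z + b * Q A y z
  Q-linˡ A a x b y z = trans (dot-+ˡ (a ·ᵛ x) (b ·ᵛ y) (A ⊡ z))
      (+-cong (dot-·ˡ a x (A ⊡ z)) (dot-·ˡ b y (A ⊡ z)))

  Q-linʳ : ∀ {N} {A : Matrix N} → Symmetric A → ∀ z a x b y →
           Q A z (a ·ᵛ x ⊹ b ·ᵛ y) ≈ a * Q A z x + b * Q A z y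
  Q-linʳ {A = A} A-sym z a x b y = trans (Q-sym A-sym z _) (trans (Q-linˡ A a x b y z)
    (+-cong (*-congˡ (Q-sym A-sym x z)) (*-congˡ (Q-sym A-sym y z))))

  Q-square : ∀ {N} {A : Matrix N} → Symmetric A → ∀ a x b y →
             Q A (a ·ᵛ x ⊹ b ·ᵛ y) (a ·ᵛ x ⊹ b ·ᵛ y) ≈
             a * a * Q A x x + (a * b * Q A x y + a * b * Q A x y) + b * b * Q A y y
  Q-square {A = A} A-sym a x b y = begin
    Q A (a ·ᵛ x ⊹ b ·ᵛ y) w                                        ≈⟨ Q-linˡ A a x b y w ⟩
    a * Q A x w + b * Q A y w
      ≈⟨ +-cong (*-congˡ (Q-linʳ A-sym x a x b y)) (*-congˡ (Q-linʳ A-sym y a x b y)) ⟩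
    a * (a * Q A x x + b * Q A x y) + b * (a * Q A y x + b * Q A y y)
      ≈⟨ +-congˡ (*-congˡ (+-congʳ (*-congˡ (Q-sym A-sym y x)))) ⟩
    a * (a * Q A x x + b * Q A x y) + b * (a * Q A x y + b * Q A y y)
      ≈⟨ solve 5 (λ a b p q r → a :* (a :* p :+ b :* q) :+ b :* (a :* q :+ b :* r) :=
                   a :* a :* p :+ (a :* b :* q :+ a :* b :* q) :+ b :* b :* r) refl a b (Q A x x)
                       (Q A x y) (Q A y y) ⟩
    a * a * Q A x x + (a * b * Q A x y + a * b * Q A x y) + b * b * Q A y y ∎
    where w = a ·ᵛ x ⊹ b ·ᵛ y

  Q-nonneg : ∀ {N} {A : Matrix N} {x y : Vector N} → (∀ i j → 0# ≤ A i j) → (∀ i → 0# ≤ x i) →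
      (∀ i → 0# ≤ y i) → 0# ≤ Q A x y
  Q-nonneg 0≤A 0≤x 0≤y = sum-nonneg _ λ i → *-nonneg (0≤x i) (sum-nonneg _ λ j → *-nonneg (0≤A i j) (0≤y j))

  infixl 6 _+ᴹ_
  _+ᴹ_ : ∀ {N} → Matrix N → Matrix N → Matrix N
  (A +ᴹ B) i j = A i j + B i j

  infixl 7 _·ᴹ_
  _·ᴹ_ : ∀ {N} → Carrier → Matrix N → Matrix N
  (a ·ᴹ A) i j = a * A i j

  Q-+ᴹ : ∀ {N} (A B : Matrix N) x y → Q (A +ᴹ B) x y ≈ Q A x y + Q B x y
  Q-+ᴹ A B x y = begin
    dot x ((A +ᴹ B) ⊡ y)           ≈⟨ dot-cong {x = x} (λ _ → refl) (λ i → dot-+ˡ (A i) (B i) y) ⟩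
    dot x ((A ⊡ y) ⊹ (B ⊡ y))      ≈⟨ dot-comm x ((A ⊡ y) ⊹ (B ⊡ y)) ⟩
    dot ((A ⊡ y) ⊹ (B ⊡ y)) x      ≈⟨ dot-+ˡ (A ⊡ y) (B ⊡ y) x ⟩
    dot (A ⊡ y) x + dot (B ⊡ y) x  ≈⟨ +-cong (dot-comm (A ⊡ y) x) (dot-comm (B ⊡ y) x) ⟩
    Q A x y + Q B x y              ∎

  Q-·ᴹ : ∀ {N} a (A : Matrix N) x y → Q (a ·ᴹ A) x y ≈ a * Q A x y
  Q-·ᴹ a A x y = begin
    dot x ((a ·ᴹ A) ⊡ y)   ≈⟨ dot-cong {x = x} (λ _ → refl) (λ i → dot-·ˡ a (A i) y) ⟩
    dot x (a ·ᵛ (A ⊡ y))   ≈⟨ dot-comm x (a ·ᵛ (A ⊡ y)) ⟩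
    dot (a ·ᵛ (A ⊡ y)) x   ≈⟨ dot-·ˡ a (A ⊡ y) x ⟩
    a * dot (A ⊡ y) x      ≈⟨ *-congˡ (dot-comm (A ⊡ y) x) ⟩
    a * Q A x y            ∎

  -- For a symmetric matrix this is the condition of having at most one positive eigenvalue, phrased
  -- through orthogonality so that no diagonalisation is involved.
  Lorentzian : ∀ {N} → Matrix N → Set _
  Lorentzian A = ∀ x y → 0# < Q A x x → Q A x y ≈ 0# → Q A y y ≤ 0#

  Lorentzian-cong : ∀ {N} {A B : Matrix N} → A ≋ B → Lorentzian A → Lorentzian B
  Lorentzian-cong A≋B lor x y 0<xx xy≈0 =
    ≤-resp (Q-congᴹ A≋B y y) refl
        (lor x y (<-resp refl (sym (Q-congᴹ A≋B x x)) 0<xx) (trans (Q-congᴹ A≋B x y) xy≈0))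

  Lorentzian-·ᴹ : ∀ {N a} {A : Matrix N} → 0# < a → Lorentzian A → Lorentzian (a ·ᴹ A)
  Lorentzian-·ᴹ {a = a} {A} 0<a lor x y 0<xx xy≈0 0<yy = lor x y (cancel x 0<xx)
    (*-cancelˡ-0 0<a (trans (sym (Q-·ᴹ a A x y)) xy≈0)) (cancel y 0<yy)
    where
    cancel : ∀ x → 0# < Q (a ·ᴹ A) x x → 0# < Q A x x
    cancel x 0<xx = *-cancelˡ-pos 0<a (<-resp refl (Q-·ᴹ a A x x) 0<xx)

  Lorentzian-0 : ∀ {N} {A : Matrix N} → (∀ i j → A i j ≈ 0#) → Lorentzian A
  Lorentzian-0 {A = A} A≈0 x y 0<xx _ _ = <-irrefl (sym Q≈0) 0<xx
    where
    Q≈0 : Q A x x ≈ 0#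
    Q≈0 = sum-0 (λ i → trans (*-congˡ (sum-0 (λ j → trans (*-congʳ (A≈0 i j)) (zeroˡ _)))) (zeroʳ _))

  -- The vector `v` may be isotropic. If `x` were positive, `v` could be moved within the orthogonal
  -- complement of `x` to a positive vector `y`, contradicting the Lorentzian property at `x`.
  Lorentzian⇒nonpos-⊥ : ∀ {N} {A : Matrix N} → Symmetric A → Lorentzian A → ∀ {v p x} →
    0# ≤ Q A v v → 0# < Q A v p → Q A v x ≈ 0# → Q A x x ≤ 0#
  Lorentzian⇒nonpos-⊥ {A = A} A-sym lor {v} {p} {x} 0≤vv 0<vp vx≈0 0<xx = lor x y 0<xx xy≈0 0<yy
    where
    e d a b : Carrier
    e = Q A x x
    d = Q A p x
    -- The projection of `p` off `x`, scaled by `e` to avoid a division.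
    p′ : Vector _
    p′ = e ·ᵛ p ⊹ (- d) ·ᵛ x
    a = Q A v p′
    b = Q A p′ p′
    0<a : 0# < a
    0<a = <-resp refl (sym (trans (Q-linʳ A-sym v e p (- d) x) (trans (+-congˡ (*-congˡ vx≈0))
      (solve 3 (λ e q d → e :* q :+ :- d :* nil := e :* q) refl e (Q A v p) d)))) (*-pos 0<xx 0<vp)
    p′x≈0 : Q A p′ x ≈ 0#
    p′x≈0 = trans (Q-linˡ A e p (- d) x x) (solve 2 (λ e d → e :* d :+ :- d :* e := nil) refl e d)
    b≤0 : b ≤ 0#
    b≤0 = lor x p′ 0<xx (trans (Q-sym A-sym x p′) p′x≈0)
    -- With this choice `2 s + b` equals `1 + s`, so the form at `y` is
    -- `s * s * Q A v v + a * a * (1 + s)`, which is positive.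
    s : Carrier
    s = 1# + - b
    0<s : 0# < s
    0<s = +-pos-nonneg 0<1 (x≤0⇒0≤-x b≤0)
    y : Vector _
    y = s ·ᵛ v ⊹ a ·ᵛ p′
    xy≈0 : Q A x y ≈ 0#
    xy≈0 = trans (Q-linʳ A-sym x s v a p′)
        (trans (+-cong (*-congˡ (trans (Q-sym A-sym x v) vx≈0))
          (*-congˡ (trans (Q-sym A-sym x p′) p′x≈0)))
      (solve 2 (λ s a → s :* nil :+ a :* nil := nil) refl s a))
    0<yy : 0# < Q A y y
    0<yy = <-resp refl (sym (trans (Q-square A-sym s v a p′)
        (solve 3 (λ q a b → (one :- b) :* (one :- b) :* q :+
          ((one :- b) :* a :* a :+ (one :- b) :* a :* a) :+ a :* a :* b
           := (one :- b) :* (one :- b) :* q :+ a :* a :* (one :+ (one :- b))) refl (Q A v v) a b)))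
      (+-nonneg-pos (*-nonneg (*-nonneg (<⇒≤ 0<s) (<⇒≤ 0<s)) 0≤vv)
        (*-pos (*-pos 0<a 0<a) (+-pos-nonneg 0<1 (<⇒≤ 0<s))))

  -- The combination `z` of `x` and `y` lies in the kernel of `l`. If both `x` and `y` were
  -- positive, nonpositivity at `z` would force `l` to vanish at `x`, and then `x` itself would
  -- violate the hypothesis.
  nonpos-on-kernel⇒Lorentzian : ∀ {N} {A : Matrix N} → Symmetric A → (l : Vector N) →
    (∀ x → dot x l ≈ 0# → Q A x x ≤ 0#) → Lorentzian A
  nonpos-on-kernel⇒Lorentzian {A = A} A-sym l nonpos x y 0<xx xy≈0 0<yy = nonpos x lx≈0 0<xx
    where
    lx ly : Carrier
    lx = dot x l
    ly = dot y l
    z : Vector _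
    z = ly ·ᵛ x ⊹ (- lx) ·ᵛ y
    lz≈0 : dot z l ≈ 0#
    lz≈0 = trans (dot-+ˡ (ly ·ᵛ x) ((- lx) ·ᵛ y) l) (trans (+-cong (dot-·ˡ ly x l) (dot-·ˡ (- lx) y l))
      (solve 2 (λ a b → a :* b :+ :- b :* a := nil) refl ly lx))
    zz : Q A z z ≈ ly * ly * Q A x x + lx * lx * Q A y y
    zz = trans (Q-square A-sym ly x (- lx) y) (trans (+-congʳ (+-congˡ (+-cong (*-congˡ xy≈0) (*-congˡ xy≈0))))
      (solve 4 (λ a b p q → a :* a :* p :+ (a :* (:- b) :* nil :+ a :* (:- b) :* nil) :+ (:- b) :* (:- b) :* q
          := a :* a :* p :+ b :* b :* q) refl ly lx (Q A x x) (Q A y y)))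
    lx≈0 : lx ≈ 0#
    lx≈0 = sym (≤-antisym (λ lx<0 → contra
        (<-resp refl (solve 1 (λ x → :- x :* :- x := x :* x) refl lx)
          (*-pos (x<0⇒0<-x lx<0) (x<0⇒0<-x lx<0))))
                          (λ 0<lx → contra (*-pos 0<lx 0<lx)))
      where
      contra : ¬ (0# < lx * lx)
      contra 0<lxlx = nonpos z lz≈0
          (<-resp refl (sym zz) (+-nonneg-pos (*-nonneg (square-nonneg ly) (<⇒≤ 0<xx))
            (*-pos 0<lxlx 0<yy)))

  -- The common value of A ⊡ v and B ⊡ w is a linear form on whose kernel
  -- both summands are nonpositive.
  Lorentzian-+ : ∀ {N} {A B : Matrix N} → Symmetric A → Symmetric B → Lorentzian A → Lorentzian B →
    ∀ {v w p} → (∀ i → (A ⊡ v) i ≈ (B ⊡ w) i) → 0# ≤ Q A v v → 0# ≤ Q B w w → 0# < Q A p v →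
    Lorentzian (A +ᴹ B)
  Lorentzian-+ {A = A} {B} A-sym B-sym lorA lorB {v} {w} {p} Av≈Bw 0≤vv 0≤ww 0<pv =
    nonpos-on-kernel⇒Lorentzian (λ i j → +-cong (A-sym i j) (B-sym i j)) (A ⊡ v) λ x lx≈0 0<xx →
      let xw≈0 : Q B x w ≈ 0#
          xw≈0 = trans (sym (dot-cong {x = x} (λ _ → refl) Av≈Bw)) lx≈0
          A≤0 = Lorentzian⇒nonpos-⊥ A-sym lorA {v} {p} {x} 0≤vv (<-resp refl (Q-sym A-sym p v) 0<pv)
                  (trans (Q-sym A-sym v x) lx≈0)
          B≤0 = Lorentzian⇒nonpos-⊥ B-sym lorB {w} {p} {x} 0≤ww
                  (<-resp refl (trans (dot-cong {x = p} (λ _ → refl) Av≈Bw) (Q-sym B-sym p w)) 0<pv)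
                  (trans (Q-sym B-sym w x) xw≈0)
      in +-nonpos A≤0 B≤0 (<-resp refl (Q-+ᴹ A B x x) 0<xx)
    where
    +-nonpos : ∀ {a b} → a ≤ 0# → b ≤ 0# → a + b ≤ 0#
    +-nonpos {a} a≤0 b≤0 = ≤-trans (+-monoˡ-≤ _ a≤0) (≤-resp (sym (+-identityˡ _)) refl b≤0)

  -- If `z` paired positively with some `p`, then `Lorentzian⇒nonpos-⊥` applied to the isotropic
  -- vector `z` would make `h` nonpositive. Both signs of a unit vector are tried as `p`.
  Lorentzian-isotropic : ∀ {N} {A : Matrix N} → Symmetric A → Lorentzian A → ∀ {h z} →
    0# < Q A h h → Q A z h ≈ 0# → Q A z z ≈ 0# → ∀ i → (A ⊡ z) i ≈ 0#
  Lorentzian-isotropic {N} {A} A-sym lor {h} {z} 0<hh zh≈0 zz≈0 i = sym (≤-antisym nonneg nonpos)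
    where
    contra : ∀ p → ¬ (0# < Q A z p)
    contra p 0<zp = Lorentzian⇒nonpos-⊥ A-sym lor {z} {p} {h} (≤-reflexive (sym zz≈0)) 0<zp zh≈0 0<hh
    zi : Q A z (unit i) ≈ (A ⊡ z) i
    zi = trans (Q-sym A-sym z (unit i)) (dot-unit i (A ⊡ z))
    nonpos : (A ⊡ z) i ≤ 0#
    nonpos 0<Azi = contra (unit i) (<-resp refl (sym zi) 0<Azi)
    nonneg : 0# ≤ (A ⊡ z) i
    -- This is the negated unit vector, written as a combination so that `Q-linʳ` applies.
    nonneg Azi<0 = contra (0# ·ᵛ z ⊹ (- 1#) ·ᵛ unit i)
        (<-resp refl (sym (trans (Q-linʳ A-sym z 0# z (- 1#) (unit i))
      (trans (+-congˡ (*-congˡ zi))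
        (solve 2 (λ q a → nil :* q :+ :- one :* a := :- a) refl (Q A z z) ((A ⊡ z) i)))))
          (x<0⇒0<-x Azi<0))

  Q-rank-one : ∀ {N} (u x : Vector N) → Q (λ i j → u i * u j) x x ≈ dot u x * dot u x
  Q-rank-one u x = begin
    dot x ((λ i j → u i * u j) ⊡ x)
      ≈⟨ dot-cong {x = x} {x} {(λ i j → u i * u j) ⊡ x} {dot u x ·ᵛ u} (λ _ → refl)
           (λ i → trans (dot-·ˡ (u i) u x) (*-comm (u i) (dot u x))) ⟩
    dot x (dot u x ·ᵛ u)   ≈⟨ dot-comm x (dot u x ·ᵛ u) ⟩
    dot (dot u x ·ᵛ u) x   ≈⟨ dot-·ˡ (dot u x) u x ⟩
    dot u x * dot u x      ∎

  -- Positive semidefinite forms from equivalence classes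

  ind : Bool → Carrier
  ind true  = 1#
  ind false = 0#

  ind-nonneg : ∀ b → 0# ≤ ind b
  ind-nonneg true  = <⇒≤ 0<1
  ind-nonneg false = ≤-reflexive refl

  -- Splitting off the class of the index zero, which contributes a square.
  equivalence-PSD : ∀ {N} (r : Fin N → Fin N → Bool) → (∀ {i j} → T (r i j) → T (r j i)) →
    (∀ {i j k} → T (r i j) → T (r j k) → T (r i k)) → ∀ x → 0# ≤ Q (λ i j → ind (r i j)) x x
  equivalence-PSD {zero}  r r-sym r-trans x = ≤-reflexive refl
  equivalence-PSD {suc N} r r-sym r-trans x = ≤-resp refl (sym eq)
    (+-nonneg (square-nonneg (dot (ind ∘ r zero) x))
      (equivalence-PSD (λ i j → r′ (suc i) (suc j)) r′-sym r′-trans (x ∘ suc)))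
    where
    r′ : Fin (suc N) → Fin (suc N) → Bool
    r′ i j = r i j ∧ not (r zero i)
    open Equivalence
    T-not : ∀ {b} → T (not b) → ¬ T b
    T-not {false} _ ()
    not-T : ∀ {b} → ¬ T b → T (not b)
    not-T {false} _ = _
    not-T {true}  f = f _
    r′-sym : ∀ {i j} → T (r′ (suc i) (suc j)) → T (r′ (suc j) (suc i))
    r′-sym p with to T-∧ p
    ... | rij , n0i = from T-∧ (r-sym rij , not-T (λ r0j → T-not n0i (r-trans r0j (r-sym rij))))
    r′-trans : ∀ {i j k} → T (r′ (suc i) (suc j)) → T (r′ (suc j) (suc k)) → T (r′ (suc i) (suc k))
    r′-trans p q = from T-∧ (r-trans (proj₁ (to T-∧ p)) (proj₁ (to T-∧ q)) , proj₂ (to T-∧ p))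
    split : ∀ i j → ind (r i j) ≈ ind (r zero i) * ind (r zero j) + ind (r′ i j)
    split i j with r zero i in eqi | r zero j in eqj | r i j in eqij
    ... | true  | true  | true  = solve 0 (one := one :* one :+ nil) refl
    ... | true  | true  | false = ⊥-elim
        (≡.subst T eqij (r-trans (r-sym (≡.subst T (≡.sym eqi) _)) (≡.subst T (≡.sym eqj) _)))
    ... | true  | false | true  = ⊥-elim
        (≡.subst T eqj (r-trans (≡.subst T (≡.sym eqi) _) (≡.subst T (≡.sym eqij) _)))
    ... | true  | false | false = solve 0 (nil := one :* nil :+ nil) refl
    ... | false | true  | true  = ⊥-elim
        (≡.subst T eqi (r-trans (≡.subst T (≡.sym eqj) _) (r-sym (≡.subst T (≡.sym eqij) _))))
    ... | false | true  | false = solve 0 (nil := nil :* one :+ nil) refl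
    ... | false | false | true  = solve 0 (one := nil :* nil :+ one) refl
    ... | false | false | false = solve 0 (nil := nil :* nil :+ nil) refl
    -- By symmetry and transitivity, zero is related to itself as soon as it is related to anything,
    -- so removing its class clears its row; `r′i0` does the same for its column.
    r′0j : ∀ j → ind (r′ zero j) ≈ 0#
    r′0j j with r zero j in eq0j | r zero zero in eq00
    ... | false | _    = refl
    ... | true  | true = refl
    ... | true  | false = ⊥-elim
        (≡.subst T eq00 (r-trans (≡.subst T (≡.sym eq0j) _) (r-sym (≡.subst T (≡.sym eq0j) _))))
    r′i0 : ∀ i → ind (r′ i zero) ≈ 0#
    r′i0 i with r i zero in eqi0 | r zero i in eq0i
    ... | false | _     = refl
    ... | true  | true  = refl
    ... | true  | false = ⊥-elim (≡.subst T eq0i (r-sym (≡.subst T (≡.sym eqi0) _)))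
    tail : Q (λ i j → ind (r′ i j)) x x ≈ Q (λ i j → ind (r′ (suc i) (suc j))) (x ∘ suc) (x ∘ suc)
    tail = begin
      x zero * dot (λ j → ind (r′ zero j)) x + sum (λ i → x (suc i) * dot (λ j → ind (r′ (suc i) j)) x)
        ≈⟨ +-cong (trans (*-congˡ (sum-0 (λ j → trans (*-congʳ (r′0j j)) (zeroˡ (x j))))) (zeroʳ _))
             (sum-cong-≋ (λ i → *-congˡ
               (trans (+-congʳ (trans (*-congʳ (r′i0 (suc i))) (zeroˡ _))) (+-identityˡ _)))) ⟩
      0# + Q (λ i j → ind (r′ (suc i) (suc j))) (x ∘ suc) (x ∘ suc) ≈⟨ +-identityˡ _ ⟩
      Q (λ i j → ind (r′ (suc i) (suc j))) (x ∘ suc) (x ∘ suc) ∎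
    eq = trans (Q-congᴹ split x x)
        (trans (Q-+ᴹ (λ i j → ind (r zero i) * ind (r zero j)) (λ i j → ind (r′ i j)) x x)
          (+-cong (Q-rank-one (ind ∘ r zero) x) tail))

-- Weighted words and the forms of the contractions

module Words {c ℓ₁ ℓ₂} (ℝ : RealField c ℓ₁ ℓ₂) {n : ℕ} (ω : Fin n → RealField.Carrier ℝ) where
  open RealField ℝ hiding (zero)
  open OrderedField ℝ
  open Forms ℝ
  open ≈-Reasoning setoid

  -- Sum of ω(i₁) ⋯ ω(iₘ) φ(a + e_{i₁} + ⋯ + e_{iₘ}) over all words i₁ … iₘ.
  words : (Vec ℕ n → Carrier) → ℕ → Vec ℕ n → Carrier
  words φ zero    a = φ a
  words φ (suc m) a = sum (λ i → ω i * words φ m (a ⊕ suc i))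

module Hessians {c ℓ₁ ℓ₂} (ℝ : RealField c ℓ₁ ℓ₂) {n : ℕ} (D : DiscretePolymatroid n)
         (ω : Fin n → RealField.Carrier ℝ) (0<ω : ∀ i → RealField._<_ ℝ (RealField.0# ℝ) (ω i)) where
  open RealField ℝ hiding (zero)
  open OrderedField ℝ
  open Forms ℝ
  open Words ℝ ω
  open DiscretePolymatroid D
  open Polymatroid D
  open ≈-Reasoning setoid

  χ : Vec ℕ n → Carrier
  χ a = ind ⌊ a ∈?𝒥 ⌋

  χ-∈ : ∀ {a} → a ∈ 𝒥 → χ a ≈ 1#
  χ-∈ {a} a∈ with a ∈?𝒥
  ... | yes _  = refl
  ... | no  a∉ = contradiction a∈ a∉

  χ-∉ : ∀ {a} → a ∉ 𝒥 → χ a ≈ 0#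
  χ-∉ {a} a∉ with a ∈?𝒥
  ... | yes a∈ = contradiction a∈ a∉
  ... | no  _  = refl

  A : ℕ → Vec ℕ n → Carrier
  A = words χ

  A-nonneg : ∀ m a → 0# ≤ A m a
  A-nonneg zero    a = ind-nonneg ⌊ a ∈?𝒥 ⌋
  A-nonneg (suc m) a = sum-nonneg _ (λ i → *-nonneg (<⇒≤ (0<ω i)) (A-nonneg m (a ⊕ suc i)))

  A-∉ : ∀ m {a} → a ∉ 𝒥 → A m a ≈ 0#
  A-∉ zero        a∉ = χ-∉ a∉
  A-∉ (suc m) {a} a∉ = sum-0 (λ i → trans (*-congˡ (A-∉ m (a∉ ∘ ⊕-∈⁻ (suc i)))) (zeroʳ (ω i)))

  -- Exchange against the larger member `b` supplies, for each letter, one summand that is positive.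
  A-pos : ∀ m {a b} → a ∈ 𝒥 → b ∈ 𝒥 → m ℕ.+ ∣ a ∣ ℕ.≤ ∣ b ∣ → 0# < A m a
  A-pos zero        a∈ b∈ le = <-resp refl (sym (χ-∈ a∈)) 0<1
  A-pos (suc m) {a} {b} a∈ b∈ le with exchange a∈ b∈ (ℕ.≤-trans (ℕ.s≤s (ℕ.m≤n+m ∣ a ∣ m)) le)
  ... | i , _ , ai∈ = sum-pos _ (λ j → *-nonneg (<⇒≤ (0<ω j)) (A-nonneg m (a ⊕ suc j))) i
    (*-pos (0<ω i) (A-pos m ai∈ b∈
      (ℕ.≤-trans (ℕ.≤-reflexive (≡.trans (≡.cong (m ℕ.+_) (∣⊕∣ a i)) (ℕ.+-suc m ∣ a ∣))) le)))

  -- The vector `w` collects the letters read so far, so that `a` and `b` stay fixed during the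
  -- induction.
  A-cong : ∀ m {a b} → (∀ w → a +ᵛ w ∈ 𝒥 → b +ᵛ w ∈ 𝒥) → (∀ w → b +ᵛ w ∈ 𝒥 → a +ᵛ w ∈ 𝒥) →
           ∀ w → A m (a +ᵛ w) ≈ A m (b +ᵛ w)
  A-cong zero {a} {b} f g w with (a +ᵛ w) ∈?𝒥 | (b +ᵛ w) ∈?𝒥
  ... | yes _  | yes _  = refl
  ... | yes p  | no ¬q  = contradiction (f w p) ¬q
  ... | no ¬p  | yes q  = contradiction (g w q) ¬p
  ... | no _   | no _   = refl
  A-cong (suc m) {a} {b} f g w = sum-cong-≋ λ i → *-congˡ {ω i} (trans
    (reflexive (≡.cong (A m) (+ᵛ-⊕ a w (suc i))))
      (trans (A-cong m f g (w ⊕ suc i)) (reflexive (≡.cong (A m) (≡.sym (+ᵛ-⊕ b w (suc i)))))))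

  -- Using `parallel` in both directions, `a ⊕ suc i` and `a ⊕ suc j` have the same continuations in
  -- `𝒥`.
  A-parallel : ∀ m {a i j} → a ⊕ suc i ∈ 𝒥 → a ⊕ suc j ∈ 𝒥 → a ⊕ suc i ⊕ suc j ∉ 𝒥 →
               ∀ k l → A m (a ⊕ suc i ⊕ k ⊕ l) ≈ A m (a ⊕ suc j ⊕ k ⊕ l)
  A-parallel m {a} {i} {j} ai∈ aj∈ aij∉ k l = trans (reflexive (≡.cong (A m) (shift (suc i)))) (trans
    (A-cong m (parallel aj∈ aij∉) (parallel ai∈ (aij∉ ∘ ≡.subst (_∈ 𝒥) (⊕-comm a (suc j) (suc i))))
      (0ᵛ ⊕ k ⊕ l))
    (reflexive (≡.cong (A m) (≡.sym (shift (suc j))))))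
    where
    shift : ∀ i → a ⊕ i ⊕ k ⊕ l ≡ (a ⊕ i) +ᵛ (0ᵛ ⊕ k ⊕ l)
    shift i = ≡.trans (≡.cong (λ b → b ⊕ k ⊕ l) (≡.sym (+ᵛ-identityʳ (a ⊕ i))))
      (≡.trans (≡.cong (_⊕ l) (+ᵛ-⊕ (a ⊕ i) 0ᵛ k)) (+ᵛ-⊕ (a ⊕ i) (0ᵛ ⊕ k) l))

  -- Up to a factorial, the Hessian of the (m+2)-homogenised weighted
  -- generating polynomial of the contraction by a, evaluated at (0, ω).
  B : ℕ → Vec ℕ n → Matrix (suc n)
  B m a i j = A m (a ⊕ i ⊕ j)

  B-sym : ∀ m a → Symmetric (B m a)
  B-sym m a i j = reflexive (≡.cong (A m) (⊕-comm a i j))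

  B-∉ : ∀ m {a} → a ∉ 𝒥 → ∀ i j → B m a i j ≈ 0#
  B-∉ m a∉ i j = A-∉ m (a∉ ∘ ⊕-∈⁻ i ∘ ⊕-∈⁻ j)

  -- Indexed by a family `f` of ground elements, so that dropping its first member leaves a sum of
  -- the same kind for the induction in `ΣB-Lorentzian`.
  ΣB : ∀ {t} → (Fin t → Fin n) → ℕ → Vec ℕ n → Matrix (suc n)
  ΣB f m a i j = sum (λ s → ω (f s) * B m (a ⊕ suc (f s)) i j)

  B-suc : ∀ m a → ΣB id m a ≋ B (suc m) a
  B-suc m a i j = sum-cong-≋ λ l → *-congˡ (reflexive (≡.cong (A m)
    (≡.trans (≡.cong (_⊕ j) (⊕-comm a (suc l) i)) (⊕-comm (a ⊕ i) (suc l) j))))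

  -- The relation `r` is parallelism in the contraction by `a`: two steps that are possible
  -- separately but not together. By `split`, the form is the square of `s` minus the form of `r`,
  -- and the latter is positive semidefinite.
  B-zero-Lorentzian : ∀ {a} → a ∈ 𝒥 → Lorentzian (B 0 a)
  B-zero-Lorentzian {a} a∈ = nonpos-on-kernel⇒Lorentzian (B-sym 0 a) s nonpos
    where
    s : Vector (suc n)
    s i = χ (a ⊕ i)
    r : Fin (suc n) → Fin (suc n) → Bool
    r i j = ⌊ a ⊕ i ∈?𝒥 ⌋ ∧ (⌊ a ⊕ j ∈?𝒥 ⌋ ∧ not ⌊ a ⊕ i ⊕ j ∈?𝒥 ⌋)
    r⁻ : ∀ i j → T (r i j) → a ⊕ i ∈ 𝒥 × a ⊕ j ∈ 𝒥 × a ⊕ i ⊕ j ∉ 𝒥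
    r⁻ i j rij with a ⊕ i ∈?𝒥 | a ⊕ j ∈?𝒥 | a ⊕ i ⊕ j ∈?𝒥
    ... | yes p | yes q | no ¬r = p , q , ¬r
    r⁺ : ∀ i j → a ⊕ i ∈ 𝒥 → a ⊕ j ∈ 𝒥 → a ⊕ i ⊕ j ∉ 𝒥 → T (r i j)
    r⁺ i j p q ¬r with a ⊕ i ∈?𝒥 | a ⊕ j ∈?𝒥 | a ⊕ i ⊕ j ∈?𝒥
    ... | yes _ | yes _ | no  _ = _
    ... | yes _ | yes _ | yes r = ¬r r
    ... | yes _ | no ¬q | _     = ¬q q
    ... | no ¬p | _     | _     = ¬p p
    r-sym : ∀ i j → T (r i j) → T (r j i)
    r-sym i j rij with r⁻ i j rij
    ... | p , q , ¬r = r⁺ j i q p (¬r ∘ ≡.subst (_∈ 𝒥) (⊕-comm a j i))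
    r-trans : ∀ i j k → T (r i j) → T (r j k) → T (r i k)
    r-trans i j k rij rjk with r⁻ i j rij | r⁻ j k rjk
    -- The empty step is parallel to nothing, since it never obstructs another step.
    r-trans zero    j       k       _ _ | p , q , ¬r | _           = contradiction q ¬r
    r-trans (suc i) zero    k       _ _ | p , q , ¬r | _           = contradiction p ¬r
    r-trans (suc i) (suc j) zero    _ _ | _          | p , q , ¬r  = contradiction p ¬r
    -- If `i` and `k` could be added together, `parallel` would put `j` in place of `i`.
    r-trans (suc i) (suc j) (suc k) _ _ | p , q , ¬r | _ , q′ , ¬r′ =
      r⁺ (suc i) (suc k) p q′ (¬r′ ∘ parallel {i = i} {j} q ¬r (𝐞 k))
    split : ∀ i j → s i * s j ≈ B 0 a i j + ind (r i j)
    split i j with a ⊕ i ∈?𝒥 | a ⊕ j ∈?𝒥 | a ⊕ i ⊕ j ∈?𝒥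
    ... | yes _ | yes _ | yes _ = solve 0 (one :* one := one :+ nil) refl
    ... | yes _ | yes _ | no _  = solve 0 (one :* one := nil :+ one) refl
    ... | yes _ | no ¬q | yes r = contradiction (⊕-∈⁻ʳ i j r) ¬q
    ... | yes _ | no _  | no _  = solve 0 (one :* nil := nil :+ nil) refl
    ... | no ¬p | _     | yes r = contradiction (⊕-∈⁻ j r) ¬p
    ... | no _  | yes _ | no _  = solve 0 (nil :* one := nil :+ nil) refl
    ... | no _  | no _  | no _  = solve 0 (nil :* nil := nil :+ nil) refl
    nonpos : ∀ x → dot x s ≈ 0# → Q (B 0 a) x x ≤ 0#
    nonpos x xs≈0 0<xx = <-irrefl (sym total≈0)
        (+-pos-nonneg 0<xx (equivalence-PSD r (λ {i} {j} → r-sym i j) (λ {i} {j} {k} → r-trans i j k) x))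
      where
      total≈0 : Q (B 0 a) x x + Q (λ i j → ind (r i j)) x x ≈ 0#
      total≈0 = begin
        Q (B 0 a) x x + Q (λ i j → ind (r i j)) x x   ≈⟨ Q-+ᴹ (B 0 a) (λ i j → ind (r i j)) x x ⟨
        Q (B 0 a +ᴹ (λ i j → ind (r i j))) x x        ≈⟨ Q-congᴹ split x x ⟨
        Q (λ i j → s i * s j) x x                     ≈⟨ Q-rank-one s x ⟩
        dot s x * dot s x                             ≈⟨ *-congʳ (trans (dot-comm s x) xs≈0) ⟩
        0# * dot s x                                  ≈⟨ zeroˡ _ ⟩
        0#                                            ∎

  -- Adding the forms of the contractions one at a time

  module _ {m a top} (top∈ : top ∈ 𝒥) (2+m+∣a∣≤∣top∣ : 2 ℕ.+ m ℕ.+ ∣ a ∣ ℕ.≤ ∣ top ∣)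
           (lor : ∀ l → a ⊕ suc l ∈ 𝒥 → Lorentzian (B m (a ⊕ suc l))) where

    ΣB-sym : ∀ {t} (f : Fin t → Fin n) → Symmetric (ΣB f m a)
    ΣB-sym f i j = sum-cong-≋ λ s → *-congˡ (B-sym m (a ⊕ suc (f s)) i j)

    ΣB-nonneg : ∀ {t} (f : Fin t → Fin n) i j → 0# ≤ ΣB f m a i j
    ΣB-nonneg f i j = sum-nonneg _ (λ s → *-nonneg (<⇒≤ (0<ω (f s))) (A-nonneg m (a ⊕ suc (f s) ⊕ i ⊕ j)))

    -- Let `j = f zero` be the new element. If it cannot be added to `a`, its form is zero.
    -- Otherwise the strict inequality in `Lorentzian-+` comes from a remaining element that can be
    -- added together with `j`; if there is none, the whole sum is a multiple of the form of `j`.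
    ΣB-Lorentzian : ∀ {t} (f : Fin t → Fin n) → Lorentzian (ΣB f m a)
    ΣB-Lorentzian {zero}  f = Lorentzian-0 {A = ΣB f m a} (λ _ _ → refl)
    ΣB-Lorentzian {suc t} f with a ⊕ suc (f zero) ∈?𝒥
    ... | no aj∉ = Lorentzian-cong {A = ΣB (f ∘ suc) m a} {ΣB f m a}
            (λ i k → sym (trans (+-congʳ (trans (*-congˡ (B-∉ m aj∉ i k)) (zeroʳ _))) (+-identityˡ _)))
            (ΣB-Lorentzian (f ∘ suc))
    ... | yes aj∈ with any? (λ s → a ⊕ suc (f (suc s)) ⊕ suc (f zero) ∈?𝒥)
    ...   | yes (s₀ , asj∈) = Lorentzian-+ {A = ω j ·ᴹ B m (a ⊕ suc j)} {ΣB g m a}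
              (λ i k → *-congˡ (B-sym m (a ⊕ suc j) i k)) (ΣB-sym g)
              (Lorentzian-·ᴹ {A = B m (a ⊕ suc j)} (0<ω j) (lor j aj∈)) (ΣB-Lorentzian g)
              {v} {w} {unit zero} Av≈Bw
              (Q-nonneg {x = v} {v} (λ i k → *-nonneg (<⇒≤ (0<ω j)) (A-nonneg m (a ⊕ suc j ⊕ i ⊕ k)))
                v-nonneg v-nonneg)
              (Q-nonneg {x = w} {w} (ΣB-nonneg g) w-nonneg w-nonneg)
              -- Pairing `v` with `unit zero` gives a weighted sum of the counts at
              -- `a ⊕ suc j ⊕ suc (g s)`. The one at `s₀` is positive, as `top` leaves room for `m`
              -- further letters.
              (<-resp refl (sym (trans (dot-unit zero ((ω j ·ᴹ B m (a ⊕ suc j)) ⊡ v)) (Av zero)))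
                (sum-pos _ (λ s → *-nonneg (<⇒≤ (0<ω (g s)))
                  (*-nonneg (<⇒≤ (0<ω j)) (A-nonneg m (a ⊕ suc j ⊕ suc (g s))))) s₀
                  (*-pos (0<ω (g s₀)) (*-pos (0<ω j)
                    (A-pos m (≡.subst (_∈ 𝒥) (⊕-comm a (suc (g s₀)) (suc j)) asj∈) top∈ size)))))
      where
      g = f ∘ suc
      j = f zero
      v w : Vector (suc n)
      v k = sum (λ s → ω (g s) * unit (suc (g s)) k)
      w = ω j ·ᵛ unit (suc j)
      v-nonneg : ∀ k → 0# ≤ v k
      v-nonneg k = sum-nonneg _ (λ s → *-nonneg (<⇒≤ (0<ω (g s))) (unit-nonneg (suc (g s)) k))
      w-nonneg : ∀ k → 0# ≤ w k
      w-nonneg k = *-nonneg (<⇒≤ (0<ω j)) (unit-nonneg (suc j) k)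
      size : m ℕ.+ ∣ a ⊕ suc j ⊕ suc (g s₀) ∣ ℕ.≤ ∣ top ∣
      size = ℕ.≤-trans (ℕ.≤-reflexive
          (≡.trans (≡.cong (m ℕ.+_) (≡.trans (∣⊕∣ (a ⊕ suc j) (g s₀)) (≡.cong suc (∣⊕∣ a j))))
               (≡.trans (ℕ.+-suc m _) (≡.cong suc (ℕ.+-suc m _))))) 2+m+∣a∣≤∣top∣
      Av : ∀ i → ((ω j ·ᴹ B m (a ⊕ suc j)) ⊡ v) i ≈
                     sum (λ s → ω (g s) * (ω j * A m (a ⊕ suc j ⊕ i ⊕ suc (g s))))
      Av i = begin
        dot row v                                              ≈⟨ dot-comm row v ⟩
        dot v row
          ≈⟨ dot-sumˡ (λ s → ω (g s) ·ᵛ unit (suc (g s))) row ⟩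
        sum (λ s → dot (ω (g s) ·ᵛ unit (suc (g s))) row)
          ≈⟨ sum-cong-≋ (λ s → trans (dot-·ˡ (ω (g s)) (unit (suc (g s))) row)
              (*-congˡ (dot-unit (suc (g s)) row))) ⟩
        sum (λ s → ω (g s) * row (suc (g s)))                  ∎
        where row = (ω j ·ᴹ B m (a ⊕ suc j)) i
      Bw : ∀ i → (ΣB g m a ⊡ w) i ≈ sum (λ s → ω (g s) * (ω j * A m (a ⊕ suc (g s) ⊕ i ⊕ suc j)))
      Bw i = begin
        dot (ΣB g m a i) w               ≈⟨ dot-comm (ΣB g m a i) w ⟩
        dot w (ΣB g m a i)               ≈⟨ dot-·ˡ (ω j) (unit (suc j)) (ΣB g m a i) ⟩
        ω j * dot (unit (suc j)) (ΣB g m a i) ≈⟨ *-congˡ (dot-unit (suc j) (ΣB g m a i)) ⟩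
        ω j * ΣB g m a i (suc j)
          ≈⟨ *-distribˡ-sum (ω j) (λ s → ω (g s) * B m (a ⊕ suc (g s)) i (suc j)) ⟩
        sum (λ s → ω j * (ω (g s) * B m (a ⊕ suc (g s)) i (suc j)))
          ≈⟨ sum-cong-≋ (λ s → solve 3 (λ x y z → x :* (y :* z) := y :* (x :* z)) refl (ω j) (ω (g s)) _) ⟩
        sum (λ s → ω (g s) * (ω j * A m (a ⊕ suc (g s) ⊕ i ⊕ suc j))) ∎
      Av≈Bw : ∀ i → ((ω j ·ᴹ B m (a ⊕ suc j)) ⊡ v) i ≈ (ΣB g m a ⊡ w) i
      Av≈Bw i = trans (Av i) (trans
          (sum-cong-≋ (λ s → *-congˡ (*-congˡ (reflexive (≡.cong (A m) (perm s)))))) (sym (Bw i)))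
        where
        perm : ∀ s → a ⊕ suc j ⊕ i ⊕ suc (g s) ≡ a ⊕ suc (g s) ⊕ i ⊕ suc j
        perm s = ≡.trans (⊕-comm (a ⊕ suc j) i (suc (g s)))
            (≡.trans (≡.cong (_⊕ i) (⊕-comm a (suc j) (suc (g s)))) (⊕-comm (a ⊕ suc (g s)) (suc j) i))
    -- Every earlier index is parallel to j or a loop, so that all the forms are proportional.
    ...   | no asj∉ = Lorentzian-cong {A = κ ·ᴹ B m (a ⊕ suc j)} {ΣB f m a} proportional
              (Lorentzian-·ᴹ {A = B m (a ⊕ suc j)} 0<κ (lor j aj∈))
      where
      g = f ∘ suc
      j = f zero
      κ : Carrier
      κ = ω j + sum (λ s → ω (g s) * χ (a ⊕ suc (g s)))
      0<κ : 0# < κ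
      0<κ = +-pos-nonneg (0<ω j) (sum-nonneg _ (λ s → *-nonneg (<⇒≤ (0<ω (g s))) (A-nonneg 0 (a ⊕ suc (g s)))))
      B-parallel : ∀ s i k → χ (a ⊕ suc (g s)) * B m (a ⊕ suc j) i k ≈ B m (a ⊕ suc (g s)) i k
      B-parallel s i k with a ⊕ suc (g s) ∈?𝒥
      ... | yes as∈ = trans (*-identityˡ _) (sym (A-parallel m as∈ aj∈ (λ p → asj∉ (s , p)) i k))
      ... | no as∉  = trans (zeroˡ _) (sym (B-∉ m as∉ i k))
      proportional : κ ·ᴹ B m (a ⊕ suc j) ≋ ΣB f m a
      proportional i k = begin
        κ * b                                                       ≈⟨ distribʳ b (ω j) _ ⟩
        ω j * b + sum (λ s → ω (g s) * χ (a ⊕ suc (g s))) * b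
          ≈⟨ +-congˡ (*-distribʳ-sum b (λ s → ω (g s) * χ (a ⊕ suc (g s)))) ⟩
        ω j * b + sum (λ s → ω (g s) * χ (a ⊕ suc (g s)) * b)
          ≈⟨ +-congˡ (sum-cong-≋ (λ s → trans (*-assoc _ _ _) (*-congˡ (B-parallel s i k)))) ⟩
        ΣB f m a i k                                                ∎
        where b = B m (a ⊕ suc j) i k

  -- Passing to the contraction by `l` lowers `m` by one and raises the size of `a` by one, so the
  -- bound by `top` is kept.
  B-Lorentzian : ∀ m {a top} → a ∈ 𝒥 → top ∈ 𝒥 → suc m ℕ.+ ∣ a ∣ ℕ.≤ ∣ top ∣ → Lorentzian (B m a)
  B-Lorentzian zero    a∈ top∈ le = B-zero-Lorentzian a∈
  B-Lorentzian (suc m) {a} a∈ top∈ le = Lorentzian-cong {A = ΣB id m a} {B (suc m) a} (B-suc m a)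
    (ΣB-Lorentzian {m} {a} top∈ le (λ l al∈ → B-Lorentzian m al∈ top∈
      (ℕ.≤-trans (ℕ.≤-reflexive (≡.trans (≡.cong (suc m ℕ.+_) (∣⊕∣ a l)) (ℕ.+-suc (suc m) ∣ a ∣))) le)) id)

  -- Descent of isotropic vectors in the equality case

  h : Vector (suc n)
  h zero    = 0#
  h (suc i) = ω i

  -- The zero entry of `h` suppresses the empty step, so pairing with `h` amounts to reading one
  -- more letter.
  B⊡h : ∀ m a i → (B m a ⊡ h) i ≈ A (suc m) (a ⊕ i)
  B⊡h m a i = trans (+-congʳ (zeroʳ _)) (trans (+-identityˡ _) (sum-cong-≋ (λ l → *-comm _ (ω l))))

  dot-h : ∀ x → dot x h ≈ sum (λ i → ω i * x (suc i))
  dot-h x = trans (+-congʳ (zeroʳ _)) (trans (+-identityˡ _) (sum-cong-≋ (λ l → *-comm _ (ω l))))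

  Qhh : ∀ m a → Q (B m a) h h ≈ A (2 ℕ.+ m) a
  Qhh m a = trans (dot-comm h (B m a ⊡ h))
      (trans (dot-h (B m a ⊡ h)) (sum-cong-≋ (λ i → *-congˡ (B⊡h m a (suc i)))))

  Q-suc : ∀ m a x y → Q (B (suc m) a) x y ≈ sum (λ l → ω l * Q (B m (a ⊕ suc l)) x y)
  Q-suc m a x y = trans (Q-congᴹ (λ i j → sym (B-suc m a i j)) x y) (go id)
    where
    go : ∀ {t} (f : Fin t → Fin n) → Q (ΣB f m a) x y ≈ sum (λ s → ω (f s) * Q (B m (a ⊕ suc (f s))) x y)
    go {zero}  f = sum-0 (λ i → trans (*-congˡ (sum-0 (λ j → zeroˡ (y j)))) (zeroʳ (x i)))
    go {suc t} f = trans (Q-+ᴹ (ω (f zero) ·ᴹ B m (a ⊕ suc (f zero))) (ΣB (f ∘ suc) m a) x y)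
      (+-cong (Q-·ᴹ (ω (f zero)) (B m (a ⊕ suc (f zero))) x y) (go (f ∘ suc)))

  isotropic⇒kernel : ∀ m {a top} z → a ∈ 𝒥 → top ∈ 𝒥 → 2 ℕ.+ m ℕ.+ ∣ a ∣ ℕ.≤ ∣ top ∣ →
    Q (B m a) z h ≈ 0# → Q (B m a) z z ≈ 0# → ∀ i → (B m a ⊡ z) i ≈ 0#
  isotropic⇒kernel m {a} z a∈ top∈ le =
    Lorentzian-isotropic (B-sym m a) (B-Lorentzian m a∈ top∈ (ℕ.≤-trans (ℕ.n≤1+n _) le)) {h} {z}
      (<-resp refl (sym (Qhh m a)) (A-pos (2 ℕ.+ m) a∈ top∈ le))

  -- Since `z` is in the kernel of the form at `a`, it is orthogonal to `h` for each contraction by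
  -- `l` and hence nonpositive there. The weighted sum of these values is the vanishing value at
  -- `a`, so each of them is zero and the induction continues.
  isotropic-descent : ∀ m {a top} z → top ∈ 𝒥 → 2 ℕ.+ m ℕ.+ ∣ a ∣ ℕ.≤ ∣ top ∣ →
    Q (B m a) z h ≈ 0# → Q (B m a) z z ≈ 0# →
    ∀ w → ∣ w ∣ ≡ m → a +ᵛ w ∈ 𝒥 → ∀ i → (B 0 (a +ᵛ w) ⊡ z) i ≈ 0#
  isotropic-descent zero {a} z top∈ le zh≈0 zz≈0 w ∣w∣≡0 aw∈ i =
    ≡.subst (λ b → b ∈ 𝒥 → (B 0 b ⊡ z) i ≈ 0#) a≡a+w (λ a∈ → isotropic⇒kernel 0 z a∈ top∈ le zh≈0 zz≈0 i) aw∈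
    where
    a≡a+w : a ≡ a +ᵛ w
    a≡a+w = ≤ᵛ∧∣∣≥⇒≡ (a≤a+b a w) (ℕ.≤-reflexive (≡.trans (∣∣-+ᵛ a w)
      (≡.trans (≡.cong (∣ a ∣ ℕ.+_) ∣w∣≡0) (ℕ.+-identityʳ _))))
  isotropic-descent (suc m) {a} {top} z top∈ le zh≈0 zz≈0 w ∣w∣≡ aw∈ with ∣a∣≡suc⇒⊕ w ∣w∣≡
  ... | u , l , ≡.refl = λ i → trans (reflexive (≡.cong (λ b → (B 0 b ⊡ z) i) eq))
          (isotropic-descent m z top∈ (ℕ.≤-trans (ℕ.≤-reflexive (size l)) le) (zh′ l) (zz′ l)
              u (ℕ.suc-injective (≡.trans (≡.sym (∣⊕∣ u l)) ∣w∣≡)) alu∈ i)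
    where
    eq : a +ᵛ (u ⊕ suc l) ≡ (a ⊕ suc l) +ᵛ u
    eq = ≡.trans (≡.sym (+ᵛ-assoc a u (𝐞 l))) (+ᵛ-swap a u (𝐞 l))
    alu∈ : (a ⊕ suc l) +ᵛ u ∈ 𝒥
    alu∈ = ≡.subst (_∈ 𝒥) eq aw∈
    a∈ : a ∈ 𝒥
    a∈ = hereditary aw∈ (a≤a+b a w)
    size : ∀ l → 2 ℕ.+ m ℕ.+ ∣ a ⊕ suc l ∣ ≡ 2 ℕ.+ suc m ℕ.+ ∣ a ∣
    size l = ≡.trans (≡.cong (2 ℕ.+ m ℕ.+_) (∣⊕∣ a l)) (ℕ.+-suc (2 ℕ.+ m) ∣ a ∣)
    -- By symmetry of the forms, this is row `suc l` of the kernel equation for `B (suc m) a`.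
    zh′ : ∀ l → Q (B m (a ⊕ suc l)) z h ≈ 0#
    zh′ l = begin
      dot z (B m (a ⊕ suc l) ⊡ h)
        ≈⟨ dot-cong {x = z} (λ _ → refl)
            (λ i → trans (B⊡h m (a ⊕ suc l) i) (reflexive (≡.cong (A (suc m)) (⊕-comm a (suc l) i)))) ⟩
      dot z (λ i → A (suc m) (a ⊕ i ⊕ suc l)) ≈⟨ dot-comm z (λ i → A (suc m) (a ⊕ i ⊕ suc l)) ⟩
      dot (λ i → A (suc m) (a ⊕ i ⊕ suc l)) z
        ≈⟨ dot-cong {y = z} (λ i → B-sym (suc m) a i (suc l)) (λ _ → refl) ⟩
      (B (suc m) a ⊡ z) (suc l)               ≈⟨ isotropic⇒kernel (suc m) z a∈ top∈ le zh≈0 zz≈0 (suc l) ⟩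
      0#                                      ∎
    nonpos : ∀ l → Q (B m (a ⊕ suc l)) z z ≤ 0#
    nonpos l with a ⊕ suc l ∈?𝒥
    ... | no al∉ = ≤-reflexive (trans (Q-congᴹ {B = λ _ _ → 0#} (B-∉ m al∉) z z)
            (sum-0 (λ i → trans (*-congˡ (sum-0 (λ j → zeroˡ (z j)))) (zeroʳ (z i)))))
    ... | yes al∈ = B-Lorentzian m al∈ top∈ (ℕ.≤-trans (ℕ.n≤1+n _) le″) h z
            (<-resp refl (sym (Qhh m (a ⊕ suc l))) (A-pos (2 ℕ.+ m) al∈ top∈ le″))
              (trans (Q-sym (B-sym m (a ⊕ suc l)) h z) (zh′ l))
      where le″ = ℕ.≤-trans (ℕ.≤-reflexive (size l)) le
    zz′ : ∀ l → Q (B m (a ⊕ suc l)) z z ≈ 0#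
    -- The values are negated to become the nonnegative summands that `sum-nonneg-0` expects.
    zz′ l = trans (solve 1 (λ q → q := :- (:- q)) refl _) (trans (-‿cong (*-cancelˡ-0 (0<ω l) (sum-nonneg-0
      (λ l → ω l * - Q (B m (a ⊕ suc l)) z z)
      (λ l → *-nonneg (<⇒≤ (0<ω l)) (x≤0⇒0≤-x (nonpos l))) Σ≈0 l))) (solve 0 (:- nil := nil) refl))
      where
      Σ≈0 : sum (λ l → ω l * - Q (B m (a ⊕ suc l)) z z) ≈ 0#
      Σ≈0 = begin
        sum (λ l → ω l * - Q (B m (a ⊕ suc l)) z z)
          ≈⟨ sum-cong-≋ (λ l → solve 2 (λ x q → x :* :- q := :- one :* (x :* q)) refl (ω l) _) ⟩
        sum (λ l → - 1# * (ω l * Q (B m (a ⊕ suc l)) z z))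
          ≈⟨ *-distribˡ-sum (- 1#) (λ l → ω l * Q (B m (a ⊕ suc l)) z z) ⟨
        - 1# * sum (λ l → ω l * Q (B m (a ⊕ suc l)) z z)   ≈⟨ *-congˡ (trans (sym (Q-suc m a z z)) zz≈0) ⟩
        - 1# * 0#                                          ≈⟨ zeroʳ _ ⟩
        0#                                                 ∎

-- Counting words by content

module _ {c ℓ} (M : CommutativeMonoid c ℓ) where
  open CommutativeMonoid M
  open CommutativeMonoidSum M using (sum; sum-cong-≋)

  -- Stated for any commutative monoid in order to serve both the product of powers in `weight` and
  -- the product of factorials in `_!ᵛ`.
  sum-update : ∀ {n} (f g : Fin n → Carrier) {x} i → g i ≈ x ∙ f i → (∀ j → j ≢ i → g j ≈ f j) →
      sum g ≈ x ∙ sum f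
  sum-update f g zero    gi≈ gj≈ = trans (∙-cong gi≈ (sum-cong-≋ (λ j → gj≈ (suc j) λ ()))) (assoc _ _ _)
  sum-update f g (suc i) gi≈ gj≈ = trans
    (∙-cong (gj≈ zero λ ()) (sum-update (f ∘ suc) (g ∘ suc) i gi≈
      (λ j j≢i → gj≈ (suc j) λ { ≡.refl → j≢i ≡.refl })))
    (trans (sym (assoc _ _ _)) (trans (∙-congʳ (comm _ _)) (assoc _ _ _)))

module Counting {c ℓ₁ ℓ₂} (ℝ : RealField c ℓ₁ ℓ₂) {n : ℕ} (ω : Fin n → RealField.Carrier ℝ) where
  open RealField ℝ hiding (zero)
  open Weighted ℝ
  open OrderedField ℝ
  open Forms ℝ using (ind)
  open Words ℝ ω
  open SemiringMult semiring using (×1-homo-*; ×-homo-+)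
  open ≈-Reasoning setoid

  words-cong : ∀ {φ ψ} → (∀ a → φ a ≈ ψ a) → ∀ m a → words φ m a ≈ words ψ m a
  words-cong φ≈ψ zero    a = φ≈ψ a
  words-cong φ≈ψ (suc m) a = sum-cong-≋ (λ i → *-congˡ (words-cong φ≈ψ m (a ⊕ suc i)))

  -- The definition peels off the first letter. Peeling off the last one instead keeps the starting
  -- point `0ᵛ` fixed in the induction for `words-δ`.
  words-last : ∀ φ m a → words φ (suc m) a ≈ words (λ b → sum (λ i → ω i * φ (b ⊕ suc i))) m a
  words-last φ zero    a = refl
  words-last φ (suc m) a = sum-cong-≋ (λ i → *-congˡ (words-last φ m (a ⊕ suc i)))

  words-0 : ∀ m a → words (λ _ → 0#) m a ≈ 0#
  words-0 zero    a = refl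
  words-0 (suc m) a = sum-0 (λ i → trans (*-congˡ (words-0 m (a ⊕ suc i))) (zeroʳ (ω i)))

  words-+ : ∀ φ ψ m a → words (λ b → φ b + ψ b) m a ≈ words φ m a + words ψ m a
  words-+ φ ψ zero    a = refl
  words-+ φ ψ (suc m) a = trans
    (sum-cong-≋ (λ i → trans (*-congˡ (words-+ φ ψ m (a ⊕ suc i))) (distribˡ (ω i) _ _)))
    (∑-distrib-+ (λ i → ω i * words φ m (a ⊕ suc i)) (λ i → ω i * words ψ m (a ⊕ suc i)))

  words-*ˡ : ∀ x φ m a → words (λ b → x * φ b) m a ≈ x * words φ m a
  words-*ˡ x φ zero    a = refl
  words-*ˡ x φ (suc m) a = trans
    (sum-cong-≋ (λ i → trans (*-congˡ (words-*ˡ x φ m (a ⊕ suc i)))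
      (solve 3 (λ y x w → y :* (x :* w) := x :* (y :* w)) refl (ω i) x (words φ m (a ⊕ suc i)))))
    (sym (*-distribˡ-sum x (λ i → ω i * words φ m (a ⊕ suc i))))

  words-sum : ∀ {t} (φ : Fin t → Vec ℕ n → Carrier) m a →
              words (λ b → sum (λ s → φ s b)) m a ≈ sum (λ s → words (φ s) m a)
  words-sum {zero}  φ m a = words-0 m a
  words-sum {suc t} φ m a = trans (words-+ (φ zero) (λ b → sum (λ s → φ (suc s) b)) m a)
      (+-congˡ (words-sum (φ ∘ suc) m a))

  sumᴸ : ∀ {A : Set} → (A → Carrier) → List A → Carrier
  sumᴸ f xs = List.foldr _+_ 0# (List.map f xs)

  words-sumᴸ : ∀ {A : Set} (φ : A → Vec ℕ n → Carrier) xs m a →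
               words (λ b → sumᴸ (λ x → φ x b) xs) m a ≈ sumᴸ (λ x → words (φ x) m a) xs
  words-sumᴸ φ []       m a = words-0 m a
  words-sumᴸ φ (x ∷ xs) m a = trans (words-+ (φ x) (λ b → sumᴸ (λ x → φ x b) xs) m a)
      (+-congˡ (words-sumᴸ φ xs m a))

  sumᴸ-cong : ∀ {A : Set} {f g : A → Carrier} → (∀ x → f x ≈ g x) → ∀ xs → sumᴸ f xs ≈ sumᴸ g xs
  sumᴸ-cong f≈g []       = refl
  sumᴸ-cong f≈g (x ∷ xs) = +-cong (f≈g x) (sumᴸ-cong f≈g xs)

  δ : Vec ℕ n → Vec ℕ n → Carrier
  δ a b = ind ⌊ Vec.≡-dec ℕ._≟_ b a ⌋

  δ-≡ : ∀ a → δ a a ≈ 1#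
  δ-≡ a with Vec.≡-dec ℕ._≟_ a a
  ... | yes _  = refl
  ... | no a≢a = contradiction ≡.refl a≢a

  δ-≢ : ∀ {a b} → b ≢ a → δ a b ≈ 0#
  δ-≢ {a} {b} b≢a with Vec.≡-dec ℕ._≟_ b a
  ... | yes b≡a = contradiction b≡a b≢a
  ... | no _    = refl

  δ-⊕ : ∀ a b i → δ (a ⊕ suc i) (b ⊕ suc i) ≈ δ a b
  δ-⊕ a b i with Vec.≡-dec ℕ._≟_ b a
  ... | yes ≡.refl = δ-≡ (a ⊕ suc i)
  ... | no b≢a     = δ-≢ (b≢a ∘ ⊕-injective)
    where
    ⊕-injective : b ⊕ suc i ≡ a ⊕ suc i → b ≡ a
    ⊕-injective eq = ≤ᵛ∧∣∣≥⇒≡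
      (λ j → ℕ.+-cancelʳ-≤ (lookup (𝐞 i) j) _ _ (ℕ.≤-reflexive (≡.trans (≡.sym (lookup-+ᵛ b (𝐞 i) j))
        (≡.trans (≡.cong (λ v → lookup v j) eq) (lookup-+ᵛ a (𝐞 i) j)))))
      (ℕ.≤-reflexive (ℕ.suc-injective (≡.trans (≡.sym (∣⊕∣ a i)) (≡.trans (≡.cong ∣_∣ (≡.sym eq)) (∣⊕∣ b i)))))

  sumᴸ-δ-∉ : ∀ {b} xs → b ∉ xs → sumᴸ (λ a → δ a b) xs ≈ 0#
  sumᴸ-δ-∉ []       b∉ = refl
  sumᴸ-δ-∉ (x ∷ xs) b∉ = trans (+-cong (δ-≢ (b∉ ∘ here)) (sumᴸ-δ-∉ xs (b∉ ∘ there))) (+-identityˡ 0#)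

  sumᴸ-δ-∈ : ∀ {b xs} → Unique xs → b ∈ xs → sumᴸ (λ a → δ a b) xs ≈ 1#
  sumᴸ-δ-∈ {b} {_ ∷ xs} (b≢ ∷ _) (here ≡.refl) =
    trans (+-cong (δ-≡ b) (sumᴸ-δ-∉ xs (λ b∈ → All.lookup b≢ b∈ ≡.refl))) (+-identityʳ 1#)
  sumᴸ-δ-∈ (x≢ ∷ u) (there b∈) =
    trans (+-cong (δ-≢ (λ b≡x → All.lookup x≢ b∈ (≡.sym b≡x))) (sumᴸ-δ-∈ u b∈)) (+-identityˡ 1#)

  0<m·1 : ∀ m .{{_ : NonZero m}} → 0# < m · 1#
  0<m·1 (suc m) = 0<[1+m]·1 m

  recip-* : ∀ m k .{{_ : NonZero m}} .{{_ : NonZero k}} .{{_ : NonZero (m ℕ.* k)}} →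
            m · 1# * recip (m ℕ.* k) ≈ recip k
  recip-* m k = *-cancelˡ (0<m·1 k) (begin
    k · 1# * (m · 1# * recip (m ℕ.* k))   ≈⟨ solve 3 (λ x y z → x :* (y :* z) := y :* x :* z) refl _ _ _ ⟩
    m · 1# * (k · 1#) * recip (m ℕ.* k)   ≈⟨ *-congʳ (×1-homo-* m k) ⟨
    (m ℕ.* k) · 1# * recip (m ℕ.* k)      ≈⟨ recip-inverse (m ℕ.* k) ⟩
    1#                                    ≈⟨ recip-inverse k ⟨
    k · 1# * recip k                      ∎)

  recip-cong : ∀ m k .{{p : NonZero m}} .{{q : NonZero k}} → m ≡ k → recip m ≡ recip k
  recip-cong _ _ ≡.refl = ≡.refl

  weight-⊕ : ∀ a i → weight ω (a ⊕ suc i) ≈ ω i * weight ω a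
  weight-⊕ a i = sum-update *-commutativeMonoid (λ j → ω j ^ lookup a j)
      (λ j → ω j ^ lookup (a ⊕ suc i) j) {ω i} i
    (reflexive (≡.cong (ω i ^_) (lookup-⊕-≡ a i)))
    (λ j j≢i → reflexive (≡.cong (ω j ^_) (lookup-⊕-≢ a j≢i)))

  !ᵛ-⊕ : ∀ (a : Vec ℕ n) i → (a ⊕ suc i) !ᵛ ≡ suc (lookup a i) ℕ.* a !ᵛ
  !ᵛ-⊕ a i = sum-update ℕ.*-1-commutativeMonoid (λ j → lookup a j !)
      (λ j → lookup (a ⊕ suc i) j !) {suc (lookup a i)} i
    (≡.cong _! (lookup-⊕-≡ a i)) (λ j j≢i → ≡.cong _! (lookup-⊕-≢ a j≢i))

  -- Adding a unit at `i` multiplies the weight by `ω i` and the factorial by the new entry.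
  term-⊕ : ∀ a i → ω i * term ω a ≈ lookup (a ⊕ suc i) i · 1# * term ω (a ⊕ suc i)
  term-⊕ a i = sym (begin
    lookup (a ⊕ suc i) i · 1# * (weight ω (a ⊕ suc i) * recip ((a ⊕ suc i) !ᵛ))
      ≈⟨ *-cong (reflexive (≡.cong (_· 1#) (lookup-⊕-≡ a i)))
          (*-cong (weight-⊕ a i) (reflexive (recip-cong ((a ⊕ suc i) !ᵛ) (l ℕ.* a !ᵛ) (!ᵛ-⊕ a i)))) ⟩
    l · 1# * (ω i * weight ω a * recip (l ℕ.* a !ᵛ))
      ≈⟨ solve 4 (λ l o w r → l :* (o :* w :* r) := o :* (w :* (l :* r))) refl (l · 1#) (ω i) (weight ω a) _ ⟩
    ω i * (weight ω a * (l · 1# * recip (l ℕ.* a !ᵛ)))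
      ≈⟨ *-congˡ (*-congˡ (recip-* l (a !ᵛ))) ⟩
    ω i * (weight ω a * recip (a !ᵛ)) ∎)
    where
    l = suc (lookup a i)
    instance
      _ = !ᵛ-nonZero a
      _ = !ᵛ-nonZero (a ⊕ suc i)
      _ = ℕ.m*n≢0 (suc (lookup a i)) (a !ᵛ)

  term-0ᵛ : ∀ a → ∣ a ∣ ≡ 0 → term ω a ≈ 1#
  term-0ᵛ a ∣a∣≡0 = begin
    weight ω a * recip (a !ᵛ)
      ≈⟨ *-cong (weight-0 ω a ∣a∣≡0) (reflexive (recip-cong (a !ᵛ) 1 (fact-0 a ∣a∣≡0))) ⟩
    1# * recip 1               ≈⟨ *-congʳ (+-identityʳ 1#) ⟨
    1 · 1# * recip 1           ≈⟨ recip-inverse 1 ⟩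
    1#                         ∎
    where
    instance _ = !ᵛ-nonZero a
    weight-0 : ∀ {n} (ω : Fin n → Carrier) a → ∣ a ∣ ≡ 0 → weight ω a ≈ 1#
    weight-0 ω []         _ = refl
    weight-0 ω (zero ∷ a) p = trans (*-identityˡ _) (weight-0 (ω ∘ suc) a p)
    fact-0 : ∀ {n} (a : Vec ℕ n) → ∣ a ∣ ≡ 0 → a !ᵛ ≡ 1
    fact-0 []         _ = ≡.refl
    fact-0 (zero ∷ a) p = ≡.trans (ℕ.+-identityʳ _) (fact-0 a p)

  sum-lookup : ∀ {n} (a : Vec ℕ n) → sum (λ i → lookup a i · 1#) ≈ ∣ a ∣ · 1#
  sum-lookup []      = refl
  sum-lookup (x ∷ a) = trans (+-congˡ (sum-lookup a)) (sym (×-homo-+ 1# x ∣ a ∣))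

  sized : ℕ → Vec ℕ n → Carrier
  sized k a = ind ⌊ ∣ a ∣ ℕ.≟ k ⌋

  sized-⊕ : ∀ k a i → sized (suc k) (a ⊕ suc i) ≡ sized k a
  sized-⊕ k a i with ∣ a ∣ ℕ.≟ k | ∣ a ⊕ suc i ∣ ℕ.≟ suc k
  ... | yes _ | yes _ = ≡.refl
  ... | no _  | no _  = ≡.refl
  ... | yes p | no ¬q = contradiction (≡.trans (∣⊕∣ a i) (≡.cong suc p)) ¬q
  ... | no ¬p | yes q = contradiction (ℕ.suc-injective (≡.trans (≡.sym (∣⊕∣ a i)) q)) ¬p

  -- That is, a is the content of |a|! / a! words.
  words-δ : ∀ k a → words (δ a) k 0ᵛ ≈ sized k a * ((k !) · 1# * term ω a)
  words-δ zero a with ∣ a ∣ ℕ.≟ 0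
  ... | yes ∣a∣≡0 = trans (trans (reflexive (≡.cong (δ a) (∣a∣≡0⇒0ᵛ≡a a ∣a∣≡0))) (δ-≡ a))
      (sym (trans (*-congˡ (*-cong (+-identityʳ 1#) (term-0ᵛ a ∣a∣≡0)))
        (solve 0 (one :* (one :* one) := one) refl)))
  ... | no ∣a∣≢0 = trans (δ-≢ {a} {0ᵛ} (λ { ≡.refl → ∣a∣≢0 (∣0ᵛ∣≡0 n) })) (sym (zeroˡ _))
  words-δ (suc k) a = begin
    words (δ a) (suc k) 0ᵛ                                      ≈⟨ words-last (δ a) k 0ᵛ ⟩
    words (λ b → sum (λ i → ω i * δ a (b ⊕ suc i))) k 0ᵛ
      ≈⟨ words-sum (λ i b → ω i * δ a (b ⊕ suc i)) k 0ᵛ ⟩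
    sum (λ i → words (λ b → ω i * δ a (b ⊕ suc i)) k 0ᵛ)
      ≈⟨ sum-cong-≋ (λ i → trans (words-*ˡ (ω i) (λ b → δ a (b ⊕ suc i)) k 0ᵛ) (last i)) ⟩
    sum (λ i → lookup a i · 1# * X)                             ≈⟨ *-distribʳ-sum X (λ i → lookup a i · 1#) ⟨
    sum (λ i → lookup a i · 1#) * X                             ≈⟨ *-congʳ (sum-lookup a) ⟩
    ∣ a ∣ · 1# * X                                              ≈⟨ total ⟩
    sized (suc k) a * ((suc k !) · 1# * term ω a)               ∎
    where
    X : Carrier
    X = sized (suc k) a * ((k !) · 1# * term ω a)
    -- Words with content `a` and last letter `i` come from words with content `b` where
    -- `a = b ⊕ suc i`, counted by induction; there are none if entry `i` of `a` is zero.
    last : ∀ i → ω i * words (λ b → δ a (b ⊕ suc i)) k 0ᵛ ≈ lookup a i · 1# * X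
    last i with lookup a i in eq
    ... | zero  = trans (*-congˡ
        (trans (words-cong (λ b → δ-≢ {a} {b ⊕ suc i}
          (λ bi≡a → ℕ.1+n≢0 (≡.trans (≡.sym (lookup-⊕-≡ b i))
            (≡.trans (≡.cong (λ v → lookup v i) bi≡a) eq)))) k 0ᵛ)
                    (words-0 k 0ᵛ))) (trans (zeroʳ (ω i)) (sym (zeroˡ X)))
    ... | suc l with ≤ᵛ-complement {a = 𝐞 i} {a} 𝐞i≤a
      where
      𝐞i≤a : 𝐞 i ≤ᵛ a
      𝐞i≤a j with j ≟ i
      ... | yes ≡.refl = ℕ.≤-trans (ℕ.≤-reflexive (lookup-𝐞-≡ i))
          (ℕ.≤-trans (ℕ.s≤s ℕ.z≤n) (ℕ.≤-reflexive (≡.sym eq)))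
      ... | no j≢i     = ℕ.≤-trans (ℕ.≤-reflexive (lookup-𝐞-≢ j≢i)) ℕ.z≤n
    ...   | b , a≡𝐞+b = trans (≡.subst
        (λ a → ω i * words (λ c → δ a (c ⊕ suc i)) k 0ᵛ ≈ lookup a i · 1# *
          (sized (suc k) a * ((k !) · 1# * term ω a)))
              (≡.trans (+ᵛ-comm b (𝐞 i)) (≡.sym a≡𝐞+b)) (shifted b)) (*-congʳ (reflexive (≡.cong (_· 1#) eq)))
      where
      shifted : ∀ b → ω i * words (λ c → δ (b ⊕ suc i) (c ⊕ suc i)) k 0ᵛ ≈
                lookup (b ⊕ suc i) i · 1# * (sized (suc k) (b ⊕ suc i) * ((k !) · 1# * term ω (b ⊕ suc i)))
      shifted b = begin
        ω i * words (λ c → δ (b ⊕ suc i) (c ⊕ suc i)) k 0ᵛ     ≈⟨ *-congˡ (words-cong (λ c → δ-⊕ b c i) k 0ᵛ) ⟩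
        ω i * words (δ b) k 0ᵛ                                  ≈⟨ *-congˡ (words-δ k b) ⟩
        ω i * (sized k b * (f * term ω b))
          ≈⟨ solve 4 (λ o s f t → o :* (s :* (f :* t)) := s :* f :* (o :* t)) refl (ω i) (sized k b) f
              (term ω b) ⟩
        sized k b * f * (ω i * term ω b)
          ≈⟨ *-cong (*-congʳ (reflexive (≡.sym (sized-⊕ k b i)))) (term-⊕ b i) ⟩
        s * f * (l′ * t)
          ≈⟨ solve 4 (λ s f l t → s :* f :* (l :* t) := l :* (s :* (f :* t))) refl s f l′ t ⟩
        l′ * (s * (f * t))                                      ∎
        where
        f = (k !) · 1#
        s = sized (suc k) (b ⊕ suc i)
        l′ = lookup (b ⊕ suc i) i · 1#
        t = term ω (b ⊕ suc i)
    -- At size `suc k` the factor `∣ a ∣` completes `k !` to `suc k !`; at every other size both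
    -- sides vanish.
    total : ∣ a ∣ · 1# * X ≈ sized (suc k) a * ((suc k !) · 1# * term ω a)
    total with ∣ a ∣ ℕ.≟ suc k
    ... | no _      = trans (*-congˡ (zeroˡ _)) (trans (zeroʳ _) (sym (zeroˡ _)))
    ... | yes ∣a∣≡ = begin
      ∣ a ∣ · 1# * (1# * (f * t))    ≈⟨ *-congʳ (reflexive (≡.cong (_· 1#) ∣a∣≡)) ⟩
      suc k · 1# * (1# * (f * t))
        ≈⟨ solve 3 (λ x f t → x :* (one :* (f :* t)) := one :* (x :* f :* t)) refl (suc k · 1#) f t ⟩
      1# * (suc k · 1# * f * t)      ≈⟨ *-congˡ (*-congʳ (×1-homo-* (suc k) (k !))) ⟨
      1# * ((suc k !) · 1# * t)      ∎
      where
      f = (k !) · 1#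
      t = term ω a

  sumᴸ-sized : ∀ k x (f : Vec ℕ n → Carrier) xs →
    sumᴸ (λ a → sized k a * (x * f a)) xs ≈ x * sumᴸ f (filter (λ a → ∣ a ∣ ℕ.≟ k) xs)
  sumᴸ-sized k x f []       = sym (zeroʳ x)
  sumᴸ-sized k x f (a ∷ xs) with ∣ a ∣ ℕ.≟ k
  ... | yes p = trans (+-cong (*-identityˡ (x * f a)) (sumᴸ-sized k x f xs))
      (trans (sym (distribˡ x (f a) (sumᴸ f (filter (λ a → ∣ a ∣ ℕ.≟ k) xs))))
      (reflexive (≡.cong (λ ys → x * sumᴸ f ys) (≡.sym (List.filter-accept (λ a → ∣ a ∣ ℕ.≟ k) {a} {xs} p)))))
  ... | no ¬p = trans (+-cong (zeroˡ (x * f a)) (sumᴸ-sized k x f xs))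
      (trans (+-identityˡ (x * sumᴸ f (filter (λ a → ∣ a ∣ ℕ.≟ k) xs)))
      (reflexive (≡.cong (λ ys → x * sumᴸ f ys) (≡.sym (List.filter-reject (λ a → ∣ a ∣ ℕ.≟ k) {a} {xs} ¬p)))))

-- The equality for word counts and its translation to `Jω`

module Main {c ℓ₁ ℓ₂} (ℝ : RealField c ℓ₁ ℓ₂) {n : ℕ} (D : DiscretePolymatroid n)
         (ω : Fin n → RealField.Carrier ℝ) (0<ω : ∀ i → RealField._<_ ℝ (RealField.0# ℝ) (ω i)) where
  open RealField ℝ hiding (zero)
  open Weighted ℝ
  open OrderedField ℝ
  open Forms ℝ
  open Words ℝ ω
  open Counting ℝ ω
  open DiscretePolymatroid D
  open Polymatroid D
  open Hessians ℝ D ω 0<ω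
  open SemiringMult semiring using (×1-homo-*)
  open ≈-Reasoning setoid

  -- As the list `𝒥` has no duplicates, `χ` is the sum of `δ a` over its members, and linearity of
  -- `words` reduces the claim to a single content.
  A≈k!·Jω : ∀ k → A k 0ᵛ ≈ (k !) · 1# * Jω D ω k
  A≈k!·Jω k = begin
    words χ k 0ᵛ                                              ≈⟨ words-cong χ≈ k 0ᵛ ⟩
    words (λ b → sumᴸ (λ a → δ a b) 𝒥) k 0ᵛ                   ≈⟨ words-sumᴸ δ 𝒥 k 0ᵛ ⟩
    sumᴸ (λ a → words (δ a) k 0ᵛ) 𝒥                           ≈⟨ sumᴸ-cong (words-δ k) 𝒥 ⟩
    sumᴸ (λ a → sized k a * ((k !) · 1# * term ω a)) 𝒥        ≈⟨ sumᴸ-sized k ((k !) · 1#) (term ω) 𝒥 ⟩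
    (k !) · 1# * Jω D ω k                                     ∎
    where
    χ≈ : ∀ b → χ b ≈ sumᴸ (λ a → δ a b) 𝒥
    χ≈ b with b ∈?𝒥
    ... | yes b∈ = sym (sumᴸ-δ-∈ unique b∈)
    ... | no b∉  = sym (sumᴸ-δ-∉ 𝒥 b∉)

  -- No word is excluded, so each letter contributes the total weight as an independent factor.
  A-Full : ∀ m a → Full (m ℕ.+ ∣ a ∣) → A m a ≈ sum ω ^ m
  A-Full zero    a full = χ-∈ (full a ℕ.≤-refl)
  A-Full (suc m) a full = trans
    (sum-cong-≋ (λ i → *-congˡ {ω i}
      (A-Full m (a ⊕ suc i) (≡.subst Full
        (≡.sym (≡.trans (≡.cong (m ℕ.+_) (∣⊕∣ a i)) (ℕ.+-suc m ∣ a ∣))) full))))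
    (sym (*-distribʳ-sum (sum ω ^ m) ω))

  Full⇒equality : ∀ m → Full (2 ℕ.+ m) → A (1 ℕ.+ m) 0ᵛ * A (1 ℕ.+ m) 0ᵛ ≈ A m 0ᵛ * A (2 ℕ.+ m) 0ᵛ
  Full⇒equality m full = begin
    A (1 ℕ.+ m) 0ᵛ * A (1 ℕ.+ m) 0ᵛ    ≈⟨ *-cong (A≈ (ℕ.n≤1+n _)) (A≈ (ℕ.n≤1+n _)) ⟩
    S * S ^ m * (S * S ^ m)
      ≈⟨ solve 2 (λ s p → s :* p :* (s :* p) := p :* (s :* (s :* p))) refl S (S ^ m) ⟩
    S ^ m * (S * (S * S ^ m))          ≈⟨ *-cong (A≈ (ℕ.≤-trans (ℕ.n≤1+n _) (ℕ.n≤1+n _))) (A≈ ℕ.≤-refl) ⟨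
    A m 0ᵛ * A (2 ℕ.+ m) 0ᵛ            ∎
    where
    S = sum ω
    A≈ : ∀ {k} → k ℕ.≤ 2 ℕ.+ m → A k 0ᵛ ≈ S ^ k
    A≈ {k} k≤ = A-Full k 0ᵛ (λ a ∣a∣≤ → full a (ℕ.≤-trans ∣a∣≤
      (ℕ.≤-trans (ℕ.≤-reflexive (≡.trans (≡.cong (k ℕ.+_) (∣0ᵛ∣≡0 n)) (ℕ.+-identityʳ k))) k≤)))

  equality⇒Full : Nondegenerate → ∀ m {top} → top ∈ 𝒥 → 2 ℕ.+ m ℕ.≤ ∣ top ∣ →
    A (1 ℕ.+ m) 0ᵛ * A (1 ℕ.+ m) 0ᵛ ≈ A m 0ᵛ * A (2 ℕ.+ m) 0ᵛ → Full (2 ℕ.+ m)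
  equality⇒Full nondegenerate m {top} top∈ le eq = extension-closed⇒Full nondegenerate top∈ le closed
    where
    p q r : Carrier
    p = A (2 ℕ.+ m) 0ᵛ
    q = A (1 ℕ.+ m) 0ᵛ
    r = A m 0ᵛ
    e₀ z : Vector (suc n)
    e₀ = unit zero
    -- Spans the orthogonal complement of h in the plane of e₀ and h.
    z = p ·ᵛ e₀ ⊹ (- q) ·ᵛ h
    le₀ : 2 ℕ.+ m ℕ.+ ∣ 0ᵛ {n} ∣ ℕ.≤ ∣ top ∣
    le₀ = ℕ.≤-trans (ℕ.≤-reflexive (≡.trans (≡.cong (2 ℕ.+ m ℕ.+_) (∣0ᵛ∣≡0 n)) (ℕ.+-identityʳ _))) le
    0<q : 0# < q
    0<q = A-pos (1 ℕ.+ m) 0ᵛ∈𝒥 top∈ (ℕ.≤-trans (ℕ.n≤1+n _) le₀)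
    e₀h : Q (B m 0ᵛ) e₀ h ≈ q
    e₀h = trans (dot-unit zero (B m 0ᵛ ⊡ h)) (B⊡h m 0ᵛ zero)
    e₀e₀ : Q (B m 0ᵛ) e₀ e₀ ≈ r
    e₀e₀ = trans (dot-unit zero (B m 0ᵛ ⊡ e₀)) (trans (dot-comm (B m 0ᵛ zero) e₀) (dot-unit zero (B m 0ᵛ zero)))
    zh≈0 : Q (B m 0ᵛ) z h ≈ 0#
    zh≈0 = trans (Q-linˡ (B m 0ᵛ) p e₀ (- q) h h) (trans (+-cong (*-congˡ e₀h) (*-congˡ (Qhh m 0ᵛ)))
      (solve 2 (λ p q → p :* q :+ :- q :* p := nil) refl p q))
    zz≈0 : Q (B m 0ᵛ) z z ≈ 0#
    zz≈0 = begin
      Q (B m 0ᵛ) z z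
        ≈⟨ Q-square (B-sym m 0ᵛ) p e₀ (- q) h ⟩
      p * p * Q (B m 0ᵛ) e₀ e₀ + (p * - q * Q (B m 0ᵛ) e₀ h + p * - q * Q (B m 0ᵛ) e₀ h) 
          + - q * - q * Q (B m 0ᵛ) h h
        ≈⟨ +-cong (+-cong (*-congˡ e₀e₀) (+-cong (*-congˡ e₀h) (*-congˡ e₀h))) (*-congˡ (Qhh m 0ᵛ)) ⟩
      p * p * r + (p * - q * q + p * - q * q) + - q * - q * p
        ≈⟨ solve 3 (λ p q r → p :* p :* r :+ (p :* :- q :* q :+ p :* :- q :* q) :+ :- q :* :- q :* p :=
            p :* (r :* p :- q :* q)) refl p q r ⟩
      p * (r * p - q * q)  ≈⟨ *-congˡ (trans (+-congʳ (sym eq)) (-‿inverseʳ _)) ⟩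
      p * 0#               ≈⟨ zeroʳ p ⟩
      0#                   ∎
    -- This is row `i` of `B 0 a ⊡ z = 0`. When `a ⊕ i` lies in `𝒥`, it fixes the total weight of
    -- the elements extending `a ⊕ i` as `p` divided by `q`.
    harmonic : ∀ {a} → a ∈ 𝒥 → ∣ a ∣ ≡ m → ∀ i → p * χ (a ⊕ i) ≈ q * A 1 (a ⊕ i)
    harmonic {a} a∈ ∣a∣≡m i = begin
      p * χ (a ⊕ i)
        ≈⟨ solve 3 (λ x q y → x := x :+ :- q :* y :+ q :* y) refl _ q (A 1 (a ⊕ i)) ⟩
      p * χ (a ⊕ i) + - q * A 1 (a ⊕ i) + q * A 1 (a ⊕ i)
        ≈⟨ +-congʳ (+-cong (*-congˡ (dot-unit zero (B 0 a i)))
            (*-congˡ (trans (dot-comm h (B 0 a i)) (B⊡h 0 a i)))) ⟨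
      p * dot e₀ (B 0 a i) + - q * dot h (B 0 a i) + q * A 1 (a ⊕ i)
        ≈⟨ +-congʳ (trans (dot-+ˡ (p ·ᵛ e₀) ((- q) ·ᵛ h) (B 0 a i))
            (+-cong (dot-·ˡ p e₀ (B 0 a i)) (dot-·ˡ (- q) h (B 0 a i)))) ⟨
      dot z (B 0 a i) + q * A 1 (a ⊕ i)
        ≈⟨ +-congʳ (trans (dot-comm z (B 0 a i)) Bz≈0) ⟩
      0# + q * A 1 (a ⊕ i)
        ≈⟨ +-identityˡ _ ⟩
      q * A 1 (a ⊕ i) ∎
      where
      Bz≈0 : (B 0 a ⊡ z) i ≈ 0#
      Bz≈0 = ≡.subst (λ b → (B 0 b ⊡ z) i ≈ 0#) (+ᵛ-identityˡ a)
        (isotropic-descent m z top∈ le₀ zh≈0 zz≈0 a ∣a∣≡m (≡.subst (_∈ 𝒥) (≡.sym (+ᵛ-identityˡ a)) a∈) i)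
    closed : ∀ {a} i j → ∣ a ∣ ≡ m → a ⊕ suc i ∈ 𝒥 → a ⊕ suc j ∈ 𝒥 → a ⊕ suc i ⊕ suc j ∈ 𝒥
    closed {a} i j ∣a∣≡m ai∈ aj∈ with a ⊕ suc i ⊕ suc j ∈?𝒥
    ... | yes aij∈ = aij∈
    ... | no aij∉ = ⊥-elim (<-irrefl (sym (gap≈0 j))
        (*-pos (0<ω j) (<-resp refl (sym (trans (+-cong (χ-∈ aj∈) (-‿cong (χ-∉ aij∉)))
                      (solve 0 (one :- nil := one) refl))) 0<1)))
      where
      a∈ = ⊕-∈⁻ (suc i) ai∈
      -- The weight lost at `l` in passing from `a` to `a ⊕ suc i`. The losses are nonnegative and
      -- add up to zero by `A1≈`, whereas `j` would lose `ω j`.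
      gap : Fin n → Carrier
      gap l = ω l * (χ (a ⊕ suc l) - χ (a ⊕ suc i ⊕ suc l))
      χ-decreasing : ∀ l → 0# ≤ χ (a ⊕ suc l) - χ (a ⊕ suc i ⊕ suc l)
      χ-decreasing l with a ⊕ suc l ∈?𝒥 | a ⊕ suc i ⊕ suc l ∈?𝒥
      ... | yes _ | yes _ = ≤-reflexive (sym (-‿inverseʳ 1#))
      ... | yes _ | no _  = ≤-resp refl (solve 0 (one := one :- nil) refl) (<⇒≤ 0<1)
      ... | no ¬p | yes p = contradiction (⊕-∈⁻ʳ (suc i) (suc l) p) ¬p
      ... | no _  | no _  = ≤-reflexive (sym (-‿inverseʳ 0#))
      -- Rows `zero` and `suc i` of `harmonic` have equal left sides, since both `a` and `a ⊕ suc i`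
      -- lie in `𝒥`.
      A1≈ : A 1 a ≈ A 1 (a ⊕ suc i)
      A1≈ = *-cancelˡ 0<q (begin
        q * A 1 a               ≈⟨ harmonic a∈ ∣a∣≡m zero ⟨
        p * χ a                 ≈⟨ *-congˡ (trans (χ-∈ a∈) (sym (χ-∈ ai∈))) ⟩
        p * χ (a ⊕ suc i)       ≈⟨ harmonic a∈ ∣a∣≡m (suc i) ⟩
        q * A 1 (a ⊕ suc i)     ∎)
      Σgap≈0 : sum gap ≈ 0#
      Σgap≈0 = begin
        sum gap
          ≈⟨ solve 2 (λ x y → x := (x :+ y) :- y) refl (sum gap) (A 1 (a ⊕ suc i)) ⟩
        sum gap + A 1 (a ⊕ suc i) - A 1 (a ⊕ suc i)
          ≈⟨ +-congʳ (∑-distrib-+ gap (λ l → ω l * χ (a ⊕ suc i ⊕ suc l))) ⟨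
        sum (λ l → gap l + ω l * χ (a ⊕ suc i ⊕ suc l)) - A 1 (a ⊕ suc i)
          ≈⟨ +-congʳ (sum-cong-≋ (λ l → solve 3 (λ o x y → o :* (x :- y) :+ o :* y := o :* x) refl (ω l)
              (χ (a ⊕ suc l)) (χ (a ⊕ suc i ⊕ suc l)))) ⟩
        A 1 a - A 1 (a ⊕ suc i)
          ≈⟨ trans (+-congʳ A1≈) (-‿inverseʳ _) ⟩
        0# ∎
      gap≈0 : ∀ l → gap l ≈ 0#
      gap≈0 = sum-nonneg-0 gap (λ l → *-nonneg (<⇒≤ (0<ω l)) (χ-decreasing l)) Σgap≈0

  module _ (m : ℕ) where
    private
      J₀ J₁ J₂ u κ ρ : Carrier
      J₀ = Jω D ω m
      J₁ = Jω D ω (1 ℕ.+ m)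
      J₂ = Jω D ω (2 ℕ.+ m)
      u = (m !) · 1#
      κ = suc m · 1#
      ρ = recip (suc m)

      -- The common factor is the square of `(m + 1)!`, because `m! (m + 2)!` is that square times
      -- `1 + 1/(m + 1)`.
      0<scale : 0# < (κ * u) * (κ * u)
      0<scale = *-pos 0<κu 0<κu
        where 0<κu = *-pos (0<[1+m]·1 m) (0<m·1 (m !) {{m ℕ.!≢0}})

      A₁ : A (1 ℕ.+ m) 0ᵛ ≈ κ * u * J₁
      A₁ = trans (A≈k!·Jω (1 ℕ.+ m)) (*-congʳ (×1-homo-* (suc m) (m !)))

      A₂ : A (2 ℕ.+ m) 0ᵛ ≈ (1# + κ) * (κ * u) * J₂
      A₂ = trans (A≈k!·Jω (2 ℕ.+ m))
          (*-congʳ (trans (×1-homo-* (2 ℕ.+ m) (suc m !)) (*-congˡ (×1-homo-* (suc m) (m !)))))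

      lhs : A (1 ℕ.+ m) 0ᵛ * A (1 ℕ.+ m) 0ᵛ ≈ (κ * u) * (κ * u) * J₁ ^ 2
      lhs = trans (*-cong A₁ A₁)
          (solve 2 (λ x j → x :* j :* (x :* j) := x :* x :* (j :* (j :* one))) refl (κ * u) J₁)

      rhs : A m 0ᵛ * A (2 ℕ.+ m) 0ᵛ ≈ (κ * u) * (κ * u) * ((1# + ρ) * J₀ * J₂)
      rhs = begin
        A m 0ᵛ * A (2 ℕ.+ m) 0ᵛ                        ≈⟨ *-cong (A≈k!·Jω m) A₂ ⟩
        u * J₀ * ((1# + κ) * (κ * u) * J₂)
          ≈⟨ solve 4 (λ u κ a b → u :* a :* ((one :+ κ) :* (κ :* u) :* b) := (κ :* u) :* u :*
              ((one :+ κ) :* a :* b)) refl u κ J₀ J₂ ⟩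
        (κ * u) * u * ((1# + κ) * J₀ * J₂)
          -- Writing 1 as `κ * ρ` allows `κ` to be taken out of the sum.
          ≈⟨ *-congˡ (*-congʳ (*-congʳ (+-congʳ (recip-inverse (suc m))))) ⟨
        (κ * u) * u * ((κ * ρ + κ) * J₀ * J₂)
          ≈⟨ solve 5 (λ u κ ρ a b → (κ :* u) :* u :* ((κ :* ρ :+ κ) :* a :* b) := (κ :* u) :* (κ :* u) :*
              ((one :+ ρ) :* a :* b)) refl u κ ρ J₀ J₂ ⟩
        (κ * u) * (κ * u) * ((1# + ρ) * J₀ * J₂)       ∎

    Jω-equality⇔ : (J₁ ^ 2 ≈ (1# + ρ) * J₀ * J₂) ⇔ (A (1 ℕ.+ m) 0ᵛ * A (1 ℕ.+ m) 0ᵛ ≈ A m 0ᵛ * A (2 ℕ.+ m) 0ᵛ)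
    Jω-equality⇔ = mk⇔
      (λ eq → trans lhs (trans (*-congˡ eq) (sym rhs)))
      (λ eq → *-cancelˡ 0<scale (trans (sym lhs) (trans eq rhs)))

  equality⇔polygirth : Nondegenerate → ∀ m → suc m ℕ.< rk →
    (Jω D ω (1 ℕ.+ m) ^ 2 ≈ (1# + recip (suc m)) * Jω D ω m * Jω D ω (2 ℕ.+ m)) ⇔ (polygirth ℕ.> 2 ℕ.+ m)
  equality⇔polygirth nondegenerate m lt with rk-attained lt
  ... | top , top∈ , le = mk⇔
      (Full⇒polygirth> {{n≢0}} ∘ equality⇒Full nondegenerate m top∈ le ∘ to (Jω-equality⇔ m))
      (from (Jω-equality⇔ m) ∘ Full⇒equality m ∘ polygirth>⇒Full {{n≢0}})
    where
    open Equivalence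
    -- A vector of positive size needs an entry; this gives the nonempty ground set over which
    -- `polygirth` is the least deficient number.
    nonempty-ground : ∀ {n k} (a : Vec ℕ n) → suc k ℕ.≤ ∣ a ∣ → NonZero n
    nonempty-ground (_ ∷ _) _ = _
    n≢0 : NonZero n
    n≢0 = nonempty-ground top le

theorem1p23 :
    ∀ {c ℓ₁ ℓ₂} (ℝ : RealField c ℓ₁ ℓ₂) →
    let open RealField ℝ
        open Weighted ℝ
    in
    (n : ℕ) (D : DiscretePolymatroid n) →
    let open DiscretePolymatroid D in
    Nondegenerate →
    (ω : Fin n → Carrier) → (∀ i → 0# < ω i) →
    (k : ℕ) .{{_ : NonZero k}} → k ℕ.< rk →
    (Jω D ω k ^ 2 ≈ (1# + recip k) * Jω D ω (k ∸ 1) * Jω D ω (k ℕ.+ 1))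
      ⇔ (polygirth ℕ.> k ℕ.+ 1)
-- With `k = suc m`, commuting `m + 1` turns `k + 1` into `2 + m`, while `k ∸ 1` computes to `m`.
theorem1p23 ℝ n D nondegenerate ω 0<ω (suc m) lt rewrite ℕ.+-comm m 1 =
  Main.equality⇔polygirth ℝ D ω 0<ω nondegenerate m lt
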